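{- Let $q=p^h$ with $p$ prime and $q>2$. Let $\mathcal{D}_1$ and $\mathcal{D}_2$ be two Desarguesian $(n-1)$-spreads in $\mathrm{PG}(2n-1,q)$ with at least $3$ elements in common. Then $\mathcal{D}_1$ and $\mathcal{D}_2$ share exactly $q^t+1$ elements for some $t\mid n$. In particular, if $n$ is prime, then $\mathcal{D}_1$ and $\mathcal{D}_2$ share a regulus or coincide.
   Context: An $(n-1)$-spread of $\mathrm{PG}(2n-1,q)$ is a set of $(n-1)$-spaces (projective dimension) partitioning the point set. Given an $\mathbb{F}_q$-linear isomorphism $\mathbb{F}_{q^n}^2\cong\mathbb{F}_q^{2n}$, each point of $\mathrm{PG}(1,q^n)$ (a 1-dimensional $\mathbb{F}_{q^n}$-subspace) corresponds to an $(n-1)$-space of $\mathrm{PG}(2n-1,q)$; a Desarguesian $(n-1)$-spread is the set of all $(n-1)$-spaces arising in this way from the points of $\mathrm{PG}(1,q^n)$, for some such isomorphism. A regulus in $\mathrm{PG}(2n-1,q)$ is a set of $q+1$ mutually disjoint $(n-1)$-spaces such that every line meeting $3$ of its elements meets all of its elements. "Share a regulus" means that the set of common elements is a regulus (the case of exactly $q+1$ common elements). -}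

module Defs where

open import Level using (Level; _⊔_; suc)
open import Algebra.Apartness.Bundles
  using (HeytingCommutativeRing; HeytingField)
open import Algebra.Bundles using (Ring; CommutativeRing)
open import Algebra.Construct.Pointwise using (isAbelianGroup)
open import Algebra.Definitions.RawMonoid using (sum)
open import Algebra.Module.Bundles using (LeftModule)
open import Algebra.Module.Morphism.Structures using (module LeftModuleMorphisms)
open import Algebra.Morphism.Structures using (module RingMorphisms)
open import Data.Fin.Base using (Fin)
open import Data.Nat.Base using (ℕ; _^_) renaming (_+_ to _+ℕ_; _*_ to _*ℕ_)
open import Data.Product.Base using (∃; ∃-syntax; Σ-syntax; _×_; _,_; proj₁)
open import Data.Vec.Functional using (Vector)
open import Function.Bundles using (Injection; Inverse; _⇔_)
open import Relation.Binary.Bundles using (Setoid)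
open import Relation.Binary.Construct.On as On using ()
open import Relation.Binary.PropositionalEquality.Properties as ≡ using ()
open import Relation.Nullary.Negation.Core using (¬_)
open import Relation.Unary using (Pred; _∈_; _∩_; _⊆_; _≐_)
open import Relation.Unary.Relation.Binary.Equality using (≐-setoid)

private
  variable
    a c m ℓ ℓ₁ ℓ₂ ℓm ℓr : Level

HasSize : Setoid a ℓ → ℕ → Set (a ⊔ ℓ)
HasSize A k = Inverse A (≡.setoid (Fin k))

AtLeast : ℕ → Setoid a ℓ → Set (a ⊔ ℓ)
AtLeast k A = Injection (≡.setoid (Fin k)) A

subsetoid : (A : Setoid a ℓ) → Pred (Setoid.Carrier A) ℓ₁ → Setoid (a ⊔ ℓ₁) ℓ
subsetoid A P = On.setoid {B = ∃ P} A proj₁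

-- Finiteness makes _≈_ decidable and forces the tight apartness _#_ to be
-- its negation, so a finite Heyting field is a finite field in the usual
-- sense (1# # 0# holds as 1# - 0# is invertible).
record FiniteField c ℓ₁ ℓ₂ (q : ℕ) : Set (suc (c ⊔ ℓ₁ ⊔ ℓ₂)) where
  field
    heytingField : HeytingField c ℓ₁ ℓ₂

  open HeytingField heytingField public

  commutativeRing : CommutativeRing c ℓ₁
  commutativeRing =
    HeytingCommutativeRing.commutativeRing heytingCommutativeRing

  open CommutativeRing commutativeRing public using (ring; rawRing)

  field
    hasSize : HasSize setoid q

record Extension {q} (F : FiniteField c ℓ₁ ℓ₂ q) (n : ℕ)
       : Set (suc (c ⊔ ℓ₁ ⊔ ℓ₂)) where
  private
    module F = FiniteField F
  field
    top : FiniteField c ℓ₁ ℓ₂ (q ^ n)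

  module Top = FiniteField top
  open RingMorphisms F.rawRing Top.rawRing using (IsRingHomomorphism)

  field
    embed                : F.Carrier → Top.Carrier
    isRingHomomorphism   : IsRingHomomorphism embed

coordinateSpace : (R : Ring c ℓ) → ℕ → LeftModule R c ℓ
coordinateSpace R d = record
  { Carrierᴹ     = Vector Carrier d
  ; _≈ᴹ_         = λ u v → ∀ i → u i ≈ v i
  ; _+ᴹ_         = λ u v i → u i + v i
  ; _*ₗ_         = λ r v i → r * v i
  ; 0ᴹ           = λ _ → 0#
  ; -ᴹ_          = λ v i → - v i
  ; isLeftModule = record
    { isLeftSemimodule = record
      { +ᴹ-isCommutativeMonoid = V.isCommutativeMonoid
      ; isPreleftSemimodule = record
        { *ₗ-cong      = λ r≈s u≈v i → *-cong r≈s (u≈v i)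
        ; *ₗ-zeroˡ     = λ v i → zeroˡ (v i)
        ; *ₗ-distribʳ  = λ v r s i → distribʳ (v i) r s
        ; *ₗ-identityˡ = λ v i → *-identityˡ (v i)
        ; *ₗ-assoc     = λ r s v i → *-assoc r s (v i)
        ; *ₗ-zeroʳ     = λ r i → zeroʳ r
        ; *ₗ-distribˡ  = λ r u v i → distribˡ r (u i) (v i)
        }
      }
    ; -ᴹ‿cong    = V.⁻¹-cong
    ; -ᴹ‿inverse = V.inverse
    }
  }
  where
  open Ring R
  open import Algebra.Structures using (IsAbelianGroup)
  module V = IsAbelianGroup (isAbelianGroup (Fin d) +-isAbelianGroup)

restrictScalars : {R : Ring c ℓ} {S : Ring a ℓr}
                  (f : Ring.Carrier R → Ring.Carrier S) →
                  RingMorphisms.IsRingHomomorphism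
                    (Ring.rawRing R) (Ring.rawRing S) f →
                  LeftModule S m ℓm → LeftModule R m ℓm
restrictScalars f f-hom M = record
  { Carrierᴹ     = Carrierᴹ
  ; _≈ᴹ_         = _≈ᴹ_
  ; _+ᴹ_         = _+ᴹ_
  ; _*ₗ_         = λ r v → f r *ₗ v
  ; 0ᴹ           = 0ᴹ
  ; -ᴹ_          = -ᴹ_
  ; isLeftModule = record
    { isLeftSemimodule = record
      { +ᴹ-isCommutativeMonoid = +ᴹ-isCommutativeMonoid
      ; isPreleftSemimodule = record
        { *ₗ-cong      = λ r≈s u≈v → *ₗ-cong (⟦⟧-cong r≈s) u≈v
        ; *ₗ-zeroˡ     = λ v → ≈ᴹ-trans (*ₗ-congʳ 0#-homo) (*ₗ-zeroˡ v)
        ; *ₗ-distribʳ  = λ v r s →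
            ≈ᴹ-trans (*ₗ-congʳ (+-homo r s)) (*ₗ-distribʳ v (f r) (f s))
        ; *ₗ-identityˡ = λ v → ≈ᴹ-trans (*ₗ-congʳ 1#-homo) (*ₗ-identityˡ v)
        ; *ₗ-assoc     = λ r s v →
            ≈ᴹ-trans (*ₗ-congʳ (*-homo r s)) (*ₗ-assoc (f r) (f s) v)
        ; *ₗ-zeroʳ     = λ r → *ₗ-zeroʳ (f r)
        ; *ₗ-distribˡ  = λ r u v → *ₗ-distribˡ (f r) u v
        }
      }
    ; -ᴹ‿cong    = -ᴹ‿cong
    ; -ᴹ‿inverse = -ᴹ‿inverse
    }
  }
  where
  open LeftModule M
  open RingMorphisms.IsRingHomomorphism f-hom

module _ {R : Ring c ℓ} (M : LeftModule R m ℓm) where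
  open Ring R
  open LeftModule M

  linearCombination : ∀ {d} → Vector Carrier d → Vector Carrierᴹ d → Carrierᴹ
  linearCombination x b = sum +ᴹ-rawMonoid (λ i → x i *ₗ b i)

  LinearlyIndependent : ∀ {d} → Vector Carrierᴹ d → Set (c ⊔ ℓ ⊔ ℓm)
  LinearlyIndependent b =
    ∀ x → linearCombination x b ≈ᴹ 0ᴹ → ∀ i → x i ≈ 0#

  Span : ∀ {d} → Vector Carrierᴹ d → Pred Carrierᴹ (c ⊔ ℓm)
  Span b v = ∃[ x ] v ≈ᴹ linearCombination x b

  record IsSubmodule {ℓ₁} (P : Pred Carrierᴹ ℓ₁) : Set (c ⊔ m ⊔ ℓm ⊔ ℓ₁) where
    field
      resp      : ∀ {u v} → u ≈ᴹ v → u ∈ P → v ∈ P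
      0ᴹ-closed : 0ᴹ ∈ P
      +ᴹ-closed : ∀ {u v} → u ∈ P → v ∈ P → u +ᴹ v ∈ P
      *ₗ-closed : ∀ r {v} → v ∈ P → r *ₗ v ∈ P

  -- The index d is the vector space dimension: points, lines and
  -- (n - 1)-spaces of the projective space of M have d = 1, 2 and n.
  record Subspace (d : ℕ) : Set (c ⊔ ℓ ⊔ m ⊔ suc (c ⊔ ℓm)) where
    field
      member      : Pred Carrierᴹ (c ⊔ ℓm)
      isSubmodule : IsSubmodule member
      basis       : Vector Carrierᴹ d
      basis∈      : ∀ i → basis i ∈ member
      independent : LinearlyIndependent basis
      spanning    : member ⊆ Span basis

  -- Two subspaces are equal when they have the same elements; the chosen
  -- bases are ignored.
  subspaces : ℕ → Setoid (c ⊔ ℓ ⊔ m ⊔ suc (c ⊔ ℓm)) (c ⊔ m ⊔ ℓm)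
  subspaces d = On.setoid (≐-setoid Carrierᴹ (c ⊔ ℓm)) (Subspace.member {d})

  -- Subspaces meet when they share a projective point.
  Meets : ∀ {d e} → Subspace d → Subspace e → Set (c ⊔ m ⊔ ℓm)
  Meets S T = ∃[ v ] (¬ v ≈ᴹ 0ᴹ) × v ∈ Subspace.member S × v ∈ Subspace.member T

module _ {q} (F : FiniteField c ℓ₁ ℓ₂ q) (n : ℕ) where
  private
    module F = FiniteField F

  -- The underlying vector space of PG(2n-1,q).
  V : LeftModule F.ring c ℓ₁
  V = coordinateSpace F.ring (2 *ℕ n)

  open LeftModule V using (_≈ᴹ_)

  spaces : Setoid (suc (c ⊔ ℓ₁)) (c ⊔ ℓ₁)
  spaces = subspaces V n

  Space : Set (suc (c ⊔ ℓ₁))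
  Space = Setoid.Carrier spaces

  open Setoid spaces using () renaming (_≈_ to _≋_)

  module _ (E : Extension F n) where
    open Extension E

    plane : LeftModule Top.ring c ℓ₁
    plane = coordinateSpace Top.ring 2

    planeOverBase : LeftModule F.ring c ℓ₁
    planeOverBase = restrictScalars embed isRingHomomorphism plane

    open LeftModuleMorphisms
      (LeftModule.rawLeftModule planeOverBase) (LeftModule.rawLeftModule V)
      public using () renaming (IsLeftModuleIsomorphism to IsLinearIsomorphism)

    -- A point of PG(1,qⁿ) is a one-dimensional subspace over Top, and its
    -- image is taken as a set of vectors of V.
    Image : (LeftModule.Carrierᴹ plane → LeftModule.Carrierᴹ V) →
            Subspace plane 1 → Pred (LeftModule.Carrierᴹ V) (c ⊔ ℓ₁)
    Image φ P v = ∃[ w ] w ∈ Subspace.member P × φ w ≈ᴹ v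

  -- The field of order qⁿ is unique up to isomorphism over F, so any model
  -- of it is allowed.
  IsDesarguesianSpread : Pred Space ℓ → Set (suc (c ⊔ ℓ₁ ⊔ ℓ₂) ⊔ ℓ)
  IsDesarguesianSpread D =
    Σ[ E ∈ Extension F n ]
    ∃[ φ ] IsLinearIsomorphism E φ ×
    (∀ S → S ∈ D ⇔ (∃[ P ] Subspace.member S ≐ Image E φ P))

  record IsRegulus (R : Pred Space ℓ) : Set (suc (c ⊔ ℓ₁) ⊔ ℓ) where
    field
      size     : HasSize (subsetoid spaces R) (q +ℕ 1)
      disjoint : ∀ {S T} → S ∈ R → T ∈ R → ¬ S ≋ T → ¬ Meets V S T
      lines    : (L : Subspace V 2) →
                 AtLeast 3 (subsetoid spaces (R ∩ Meets V L)) → R ⊆ Meets V L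

{-# OPTIONS --safe #-}

-- Each spread Dᵢ turns V into a vector space over a field Kᵢ of order qⁿ, and
-- its elements are the Kᵢ-lines of V. Three common elements contain nonzero
-- vectors a, b and a + b respectively. A K₁-line other than that of b is
-- spanned by some a + k b with k ∈ K₁, and it is also a K₂-line exactly when
-- k lies in N = K₁ ∩ K₂, the intersection being taken in End V. So the spreads
-- share |N| + 1 elements. Since N is a field between F and K₁, |N| = q^t with
-- t ∣ n. For prime n, either N = F and the common elements are those spanned
-- by b and by the a + r b with r ∈ F, which form a regulus, or N = K₁ and
-- every K₁-line is a K₂-line.

module Submission where

open import Defs
open import Level using (Level; _⊔_)
open import Algebra.Bundles using (CommutativeMonoid; RawRing; Ring)
import Algebra.Apartness.Properties.HeytingCommutativeRing as HeytingProperties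
open import Algebra.Module.Bundles using (LeftModule)
open import Algebra.Module.Bundles.Raw using (RawLeftModule)
import Algebra.Module.Construct.TensorUnit as TensorUnit
import Algebra.Module.Morphism.LeftModuleMonomorphism as LeftModuleMonomorphism
open import Algebra.Module.Morphism.Structures using (module LeftModuleMorphisms)
import Algebra.Morphism.RingMonomorphism as RingMonomorphism
open import Algebra.Morphism.Structures using (module RingMorphisms)
import Algebra.Properties.AbelianGroup as AbelianGroupProperties
import Algebra.Properties.CommutativeMonoid.Sum as Sum
open import Data.Fin.Base using (Fin; zero; suc; funToFin; finToFun)
import Data.Fin.Permutation as Perm
open import Data.Fin.Properties as Fin
  using (suc-injective; any?; funToFin-finToFin; finToFun-funToFin; injective⇒≤; +↔⊎)
open import Data.Nat.Base using (ℕ; zero; suc; _^_; _<_; _≤_; z≤n; s≤s; NonZero)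
  renaming (_+_ to _+ℕ_; _*_ to _*ℕ_)
open import Data.Nat.Divisibility using (_∣_; divides)
open import Data.Nat.Primality using (Prime; prime⇒irreducible)
import Data.Nat.Properties as ℕ
open import Data.Product.Base using (∃; ∃-syntax; _×_; _,_; proj₁; proj₂)
open import Data.Sum.Base using (_⊎_; inj₁; inj₂; [_,_]′)
open import Data.Sum.Function.Setoid using (_⊎-inverse_)
open import Data.Sum.Relation.Binary.Pointwise using (_⊎ₛ_; inj₁; inj₂; Pointwise-≡↔≡)
open import Data.Vec.Functional using (Vector; _∷_; []; tail)
open import Function.Base using (_∘_; id)
open import Function.Bundles using (Bijection; Equivalence; Injection; Inverse; _⇔_)
import Function.Construct.Composition as Comp
open import Function.Definitions using (Injective)
open import Function.Properties.Bijection using (Bijection⇒Inverse)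
open import Function.Properties.Inverse as Inv using (Inverse⇒Injection)
open import Relation.Binary.Bundles using (Setoid)
open import Relation.Binary.Definitions using (Decidable; tri<; tri≈; tri>)
open import Relation.Binary.PropositionalEquality as ≡ using (_≡_; _≢_)
import Relation.Binary.Reasoning.Setoid as ≈-Reasoning
open import Relation.Nullary using (¬_; Dec; yes; no; contradiction)
open import Relation.Nullary.Decidable using (map′; via-injection; ¬?; decidable-stable)
open import Relation.Unary as U using (Pred; _∈_; _⊆_; _≐_; _∩_)
open import Relation.Unary.Properties using (≐-sym; ≐-trans)

-- `K₁` and `K₂` are separate models of the field of order qⁿ, linked only by their actions on `V`.
-- The three common elements assign to each `z` in `K₁` a scalar `z′` in `K₂` that acts in the same
-- way on `a` and on `b`. The map from `z` to `z′` need not respect products, which is why the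
-- spreads can differ. The line of `a + k b` is common exactly when `(k z)′ = k′ z′` for all `z`,
-- and this says that `k` and `k′` act alike on all multiples of `a` and `b`, hence on `V`. The
-- divisibility comes from counting rather than from a degree formula: |N| = q^t and q^n = |N|^m by
-- coordinates over `F` and over `N`, and the exponents are compared. Bases, inverses and
-- counterexamples have to be exhibited, so they are found by search in finite sets.

private
  variable
    c p ℓ μ μ′ ℓμ ℓμ′ ℓ₁ ℓ₂ ℓ₃ ℓ₄ : Level

-- Finite sets

HasSize-unique : {A : Setoid c ℓ} {j k : ℕ} → HasSize A j → HasSize A k → j ≡ k
HasSize-unique A↔j A↔k = Perm.↔⇒≡ (Comp.inverse (Inv.sym A↔j) A↔k)

module Finite (A : Setoid c ℓ) {k : ℕ} (size : HasSize A k) where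

  open Setoid A using (Carrier; _≈_) renaming (sym to ≈-sym)
  open Inverse size

  infix 4 _≟_
  _≟_ : Decidable _≈_
  _≟_ = via-injection (Inverse⇒Injection size) Fin._≟_

  -- The enumeration reaches each element only up to `_≈_`, so `P` has to respect it.
  search : {P : Pred Carrier p} → (∀ {x y} → x ≈ y → P x → P y) →
           U.Decidable P → Dec (∃ P)
  search resp P? = map′
    (λ (i , Pi) → from i , Pi)
    (λ (x , Px) → to x , resp (≈-sym (strictlyInverseʳ x)) Px)
    (any? (P? ∘ from))

  -- The failing case carries a witness because `∃basis` extends its family by exactly such a
  -- vector.
  search-counterexample : {P : Pred Carrier p} → (∀ {x y} → x ≈ y → P x → P y) →
                          U.Decidable P → (∃[ x ] ¬ P x) ⊎ (∀ x → P x)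
  search-counterexample resp P?
    with search (λ x≈y ¬Px → ¬Px ∘ resp (≈-sym x≈y)) (¬? ∘ P?)
  ... | yes ∃¬P = inj₁ ∃¬P
  ... | no ¬∃¬P = inj₂ λ x → decidable-stable (P? x) λ ¬Px → ¬∃¬P (x , ¬Px)

enumerate : ∀ {k} {Q : Pred (Fin k) p} → U.Decidable Q →
            ∃[ j ] ∃[ f ] Injective {A = Fin j} _≡_ _≡_ f ×
            (∀ i → Q (f i)) × (∀ i → Q i → ∃[ l ] f l ≡ i)
enumerate {k = zero} Q? = 0 , (λ ()) , (λ { {()} }) , (λ ()) , (λ ())
enumerate {k = suc k} {Q} Q? with enumerate (Q? ∘ suc) | Q? zero
... | j , f , f-inj , Qf , f-surj | no ¬Q0 =
  j , suc ∘ f , f-inj ∘ suc-injective , Qf , surj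
  where
  surj : ∀ i → Q i → ∃[ l ] suc (f l) ≡ i
  surj zero    Q0 = contradiction Q0 ¬Q0
  surj (suc i) Qi with l , fl≡i ← f-surj i Qi = l , ≡.cong suc fl≡i
... | j , f , f-inj , Qf , f-surj | yes Q0 = suc j , g , g-inj , Qg , surj
  where
  g : Fin (suc j) → Fin (suc k)
  g zero    = zero
  g (suc l) = suc (f l)
  g-inj : Injective _≡_ _≡_ g
  g-inj {zero}  {zero}  _  = ≡.refl
  g-inj {suc _} {suc _} eq = ≡.cong suc (f-inj (suc-injective eq))
  Qg : ∀ l → Q (g l)
  Qg zero    = Q0
  Qg (suc l) = Qf l
  surj : ∀ i → Q i → ∃[ l ] g l ≡ i
  surj zero    _  = zero , ≡.refl
  surj (suc i) Qi with l , fl≡i ← f-surj i Qi = suc l , ≡.cong suc fl≡i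

-- An element is numbered by the position of its index in the list of those indices that satisfy
-- `P`.
subsetoidSize : (A : Setoid c ℓ) {k : ℕ} → HasSize A k →
                {P : Pred (Setoid.Carrier A) p} →
                (∀ {x y} → Setoid._≈_ A x y → P x → P y) → U.Decidable P →
                ∃[ j ] HasSize (subsetoid A P) j
subsetoidSize A size {P} resp P?
  with j , f , f-inj , Pf , f-surj ← enumerate (P? ∘ Inverse.from size) = j , record
    { to        = index
    ; from      = λ i → from (f i) , Pf i
    ; to-cong   = λ {x} {y} x≈y → f-inj (≡.trans (f-index x) (≡.trans (to-cong x≈y) (≡.sym (f-index y))))
    ; from-cong = λ { ≡.refl → A.refl }
    ; inverse   = (λ {i} {x} x≈fi → f-inj (≡.trans (f-index x) (inverseˡ x≈fi)))
                , (λ { {x} ≡.refl → inverseʳ (f-index x) })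
    }
  where
  module A = Setoid A
  open Inverse size
  indexing : (x : ∃ P) → ∃[ l ] f l ≡ to (proj₁ x)
  indexing (x , Px) = f-surj (to x) (resp (A.sym (strictlyInverseʳ x)) Px)
  index = proj₁ ∘ indexing
  f-index : ∀ x → f (index x) ≡ to (proj₁ x)
  f-index = proj₂ ∘ indexing

-- The indices of the coordinates are read as digits in base `q`.
coordinateSpaceSize : (R : Ring c ℓ) {q : ℕ} (d : ℕ) → HasSize (Ring.setoid R) q →
                      HasSize (LeftModule.≈ᴹ-setoid (coordinateSpace R d)) (q ^ d)
coordinateSpaceSize R {q} d size = record
  { to        = λ x → funToFin (to ∘ x)
  ; from      = λ i → from ∘ finToFun i
  ; to-cong   = λ x≈y → funToFin-cong (λ i → to-cong (x≈y i))
  ; from-cong = λ { ≡.refl i → Ring.refl R }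
  ; inverse   = (λ {i} x≈i → ≡.trans (funToFin-cong (λ j → inverseˡ (x≈i j))) (funToFin-finToFin {d} {q} i))
              , (λ { {x} ≡.refl j → inverseʳ (finToFun-funToFin (to ∘ x) j) })
  }
  where
  open Inverse size
  funToFin-cong : ∀ {m n} {f g : Fin m → Fin n} → (∀ i → f i ≡ g i) → funToFin f ≡ funToFin g
  funToFin-cong {zero}          f≗g = ≡.refl
  funToFin-cong {suc m} {f = f} {g} f≗g
    rewrite f≗g zero | funToFin-cong {f = f ∘ suc} {g ∘ suc} (f≗g ∘ suc) = ≡.refl

-- Linear algebra over a finite division ring

-- This bounds the length of an independent family, and with it the search for a basis.
n<m^n : ∀ {m} → 1 < m → ∀ n → n < m ^ n
n<m^n 1<m zero    = s≤s z≤n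
n<m^n 1<m (suc n) = ℕ.≤-<-trans (n<m^n 1<m n) (ℕ.^-monoʳ-< _ 1<m (ℕ.n<1+n n))

-- A common form for `F`, the fields of the spreads and the subring `N`, which is given no apartness
-- relation: inverses are demanded of whatever is not equal to zero.
record FiniteDivisionRing (R : Ring c ℓ) (q : ℕ) : Set (c ⊔ ℓ) where
  open Ring R hiding (zero)
  field
    size    : HasSize setoid q
    1≉0     : ¬ 1# ≈ 0#
    inverse : ∀ {x} → ¬ x ≈ 0# → ∃[ y ] y * x ≈ 1#

  open Finite setoid size public using (_≟_)

  1<q : 1 < q
  1<q = distinct⇒1< (1≉0 ∘ Injection.injective (Inverse⇒Injection size))
    where
    distinct⇒1< : ∀ {k} {i j : Fin k} → i ≢ j → 1 < k
    distinct⇒1< {suc zero} {zero} {zero} i≢j = contradiction ≡.refl i≢j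
    distinct⇒1< {suc (suc _)} _ = s≤s (s≤s z≤n)

module _ {R : Ring c ℓ} (M : LeftModule R μ ℓμ) where
  open Ring R hiding (zero)
  open LeftModule M
  private
    module S = Sum +ᴹ-commutativeMonoid
    module G = AbelianGroupProperties +ᴹ-abelianGroup
  open ≈-Reasoning ≈ᴹ-setoid

  -‿distribˡ-*ₗ : ∀ r v → (- r) *ₗ v ≈ᴹ -ᴹ (r *ₗ v)
  -‿distribˡ-*ₗ r v = G.inverseʳ-unique (r *ₗ v) ((- r) *ₗ v) (begin
    r *ₗ v +ᴹ (- r) *ₗ v ≈⟨ *ₗ-distribʳ v r (- r) ⟨
    (r - r) *ₗ v         ≈⟨ *ₗ-congʳ (-‿inverseʳ r) ⟩
    0# *ₗ v              ≈⟨ *ₗ-zeroˡ v ⟩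
    0ᴹ                   ∎)

  linearCombination-cong : ∀ {d} {x y : Vector Carrier d} (e : Vector Carrierᴹ d) →
    (∀ i → x i ≈ y i) → linearCombination M x e ≈ᴹ linearCombination M y e
  linearCombination-cong e x≈y = S.sum-cong-≋ λ i → *ₗ-congʳ (x≈y i)

  linearCombination-+ : ∀ {d} (x y : Vector Carrier d) (e : Vector Carrierᴹ d) →
    linearCombination M (λ i → x i + y i) e ≈ᴹ
    linearCombination M x e +ᴹ linearCombination M y e
  linearCombination-+ x y e = begin
    S.sum (λ i → (x i + y i) *ₗ e i)          ≈⟨ S.sum-cong-≋ (λ i → *ₗ-distribʳ (e i) (x i) (y i)) ⟩
    S.sum (λ i → x i *ₗ e i +ᴹ y i *ₗ e i)    ≈⟨ S.∑-distrib-+ (λ i → x i *ₗ e i) (λ i → y i *ₗ e i) ⟩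
    linearCombination M x e +ᴹ linearCombination M y e ∎

  linearCombination-* : ∀ {d} r (x : Vector Carrier d) (e : Vector Carrierᴹ d) →
    linearCombination M (λ i → r * x i) e ≈ᴹ r *ₗ linearCombination M x e
  linearCombination-* {zero}  r x e = ≈ᴹ-sym (*ₗ-zeroʳ r)
  linearCombination-* {suc d} r x e = begin
    (r * x zero) *ₗ e zero +ᴹ linearCombination M (tail λ i → r * x i) (tail e)
      ≈⟨ +ᴹ-cong (*ₗ-assoc r (x zero) (e zero)) (linearCombination-* r (tail x) (tail e)) ⟩
    r *ₗ x zero *ₗ e zero +ᴹ r *ₗ linearCombination M (tail x) (tail e)
      ≈⟨ *ₗ-distribˡ r _ _ ⟨
    r *ₗ linearCombination M x e ∎

  -- Independence is applied to the difference, written with coefficients `- 1# * y i` so that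
  -- `linearCombination-*` can treat the second summand.
  linearCombination-injective : ∀ {d} {e : Vector Carrierᴹ d} → LinearlyIndependent M e →
    ∀ {x y} → linearCombination M x e ≈ᴹ linearCombination M y e → ∀ i → x i ≈ y i
  linearCombination-injective {e = e} indep {x} {y} eq i =
    R.x∙y⁻¹≈ε⇒x≈y (x i) (y i) (trans (+-congˡ (sym (R′.-1*x≈-x (y i))))
      (indep (λ i → x i + - 1# * y i) (begin
        linearCombination M (λ i → x i + - 1# * y i) e
          ≈⟨ linearCombination-+ x (λ i → - 1# * y i) e ⟩
        linearCombination M x e +ᴹ linearCombination M (λ i → - 1# * y i) e
          ≈⟨ +ᴹ-cong eq (linearCombination-* (- 1#) y e) ⟩
        w +ᴹ (- 1#) *ₗ w
          ≈⟨ +ᴹ-congˡ (-‿distribˡ-*ₗ 1# w) ⟩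
        w +ᴹ -ᴹ (1# *ₗ w)
          ≈⟨ +ᴹ-congˡ (-ᴹ‿cong (*ₗ-identityˡ w)) ⟩
        w +ᴹ -ᴹ w
          ≈⟨ -ᴹ‿inverseʳ w ⟩
        0ᴹ ∎) i))
    where
    import Algebra.Properties.Ring R as R′
    module R = AbelianGroupProperties +-abelianGroup
    w = linearCombination M y e

module _ {R : Ring c ℓ} (M : LeftModule R μ ℓμ) (N : LeftModule R μ′ ℓμ′) where
  private
    module M = LeftModule M
    module N = LeftModule N

  linearCombination-map : (f : M.Carrierᴹ → N.Carrierᴹ) →
    f M.0ᴹ N.≈ᴹ N.0ᴹ →
    (∀ u v → f (u M.+ᴹ v) N.≈ᴹ f u N.+ᴹ f v) →
    (∀ r v → f (r M.*ₗ v) N.≈ᴹ r N.*ₗ f v) →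
    ∀ {d} (x : Vector (Ring.Carrier R) d) e →
    f (linearCombination M x e) N.≈ᴹ linearCombination N x (f ∘ e)
  linearCombination-map f f-0 f-+ f-* {zero}  x e = f-0
  linearCombination-map f f-0 f-+ f-* {suc d} x e =
    N.≈ᴹ-trans (f-+ _ _) (N.+ᴹ-cong (f-* (x zero) (e zero))
      (linearCombination-map f f-0 f-+ f-* (tail x) (tail e)))

module VectorSpace {R : Ring c ℓ} {q : ℕ} (D : FiniteDivisionRing R q)
                   (M : LeftModule R μ ℓμ) where
  open Ring R hiding (zero)
  open LeftModule M
  open FiniteDivisionRing D
  open ≈-Reasoning ≈ᴹ-setoid
  private
    module G = AbelianGroupProperties +ᴹ-abelianGroup

  invert : ∀ {r u v} → (r≉0 : ¬ r ≈ 0#) → r *ₗ u ≈ᴹ v → u ≈ᴹ proj₁ (inverse r≉0) *ₗ v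
  invert {r} {u} {v} r≉0 ru≈v with s , sr≈1 ← inverse r≉0 = begin
    u            ≈⟨ *ₗ-identityˡ u ⟨
    1# *ₗ u      ≈⟨ *ₗ-congʳ sr≈1 ⟨
    (s * r) *ₗ u ≈⟨ *ₗ-assoc s r u ⟩
    s *ₗ r *ₗ u  ≈⟨ *ₗ-congˡ ru≈v ⟩
    s *ₗ v       ∎

  *ₗ-≉0 : ∀ {r v} → ¬ r ≈ 0# → ¬ v ≈ᴹ 0ᴹ → ¬ r *ₗ v ≈ᴹ 0ᴹ
  *ₗ-≉0 r≉0 v≉0 rv≈0 = v≉0 (≈ᴹ-trans (invert r≉0 rv≈0) (*ₗ-zeroʳ _))

  *ₗ-cancelʳ : ∀ {r s v} → ¬ v ≈ᴹ 0ᴹ → r *ₗ v ≈ᴹ s *ₗ v → r ≈ s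
  *ₗ-cancelʳ {r} {s} {v} v≉0 rv≈sv with r - s ≟ 0#
  ... | yes r-s≈0 = x∙y⁻¹≈ε⇒x≈y r s r-s≈0
    where open AbelianGroupProperties +-abelianGroup
  ... | no r-s≉0 = contradiction (begin
    (r - s) *ₗ v            ≈⟨ *ₗ-distribʳ v r (- s) ⟩
    r *ₗ v +ᴹ (- s) *ₗ v    ≈⟨ +ᴹ-cong rv≈sv (-‿distribˡ-*ₗ M s v) ⟩
    s *ₗ v +ᴹ -ᴹ (s *ₗ v)   ≈⟨ -ᴹ‿inverseʳ _ ⟩
    0ᴹ                      ∎) (*ₗ-≉0 r-s≉0 v≉0)

  Line : Carrierᴹ → Pred Carrierᴹ (c ⊔ ℓμ)
  Line u v = ∃[ r ] v ≈ᴹ r *ₗ u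

  Line-refl : ∀ {u} → Line u u
  Line-refl = 1# , ≈ᴹ-sym (*ₗ-identityˡ _)

  Line-trans : ∀ {u v w} → Line u v → Line v w → Line u w
  Line-trans (r , v≈ru) (s , w≈sv) =
    s * r , ≈ᴹ-trans w≈sv (≈ᴹ-trans (*ₗ-congˡ v≈ru) (≈ᴹ-sym (*ₗ-assoc s r _)))

  Line-sym : ∀ {u v} → ¬ v ≈ᴹ 0ᴹ → Line u v → Line v u
  Line-sym {u} v≉0 (r , v≈ru) = _ , invert r≉0 (≈ᴹ-sym v≈ru)
    where
    r≉0 : ¬ r ≈ 0#
    r≉0 r≈0 = v≉0 (≈ᴹ-trans v≈ru (≈ᴹ-trans (*ₗ-congʳ r≈0) (*ₗ-zeroˡ u)))

  Line-isSubmodule : ∀ u → IsSubmodule M (Line u)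
  Line-isSubmodule u = record
    { resp      = λ { v≈w (r , v≈ru) → r , ≈ᴹ-trans (≈ᴹ-sym v≈w) v≈ru }
    ; 0ᴹ-closed = 0# , ≈ᴹ-sym (*ₗ-zeroˡ u)
    ; +ᴹ-closed = λ { (r , v≈ru) (s , w≈su) →
        r + s , ≈ᴹ-trans (+ᴹ-cong v≈ru w≈su) (≈ᴹ-sym (*ₗ-distribʳ u r s)) }
    ; *ₗ-closed = λ s v∈ → Line-trans v∈ (s , ≈ᴹ-refl)
    }

  Plane : Carrierᴹ → Carrierᴹ → Pred Carrierᴹ (c ⊔ ℓμ)
  Plane u v w = ∃[ r ] ∃[ s ] w ≈ᴹ r *ₗ u +ᴹ s *ₗ v

  Plane-swap : ∀ {u v w} → Plane u v w → Plane v u w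
  Plane-swap (r , s , w≈) = s , r , ≈ᴹ-trans w≈ (+ᴹ-comm _ _)

  Plane-trans : ∀ {u v u′ v′ w} → Plane u v u′ → Plane u v v′ → Plane u′ v′ w → Plane u v w
  Plane-trans {u} {v} {u′} {v′} {w} (r , s , u′≈) (r′ , s′ , v′≈) (x , y , w≈) =
    x * r + y * r′ , x * s + y * s′ , (begin
    w
      ≈⟨ w≈ ⟩
    x *ₗ u′ +ᴹ y *ₗ v′
      ≈⟨ +ᴹ-cong (*ₗ-congˡ u′≈) (*ₗ-congˡ v′≈) ⟩
    x *ₗ (r *ₗ u +ᴹ s *ₗ v) +ᴹ y *ₗ (r′ *ₗ u +ᴹ s′ *ₗ v)
      ≈⟨ +ᴹ-cong (scale x r s) (scale y r′ s′) ⟩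
    ((x * r) *ₗ u +ᴹ (x * s) *ₗ v) +ᴹ ((y * r′) *ₗ u +ᴹ (y * s′) *ₗ v)
      ≈⟨ interchange _ _ _ _ ⟩
    ((x * r) *ₗ u +ᴹ (y * r′) *ₗ u) +ᴹ ((x * s) *ₗ v +ᴹ (y * s′) *ₗ v)
      ≈⟨ +ᴹ-cong (*ₗ-distribʳ u _ _) (*ₗ-distribʳ v _ _) ⟨
    (x * r + y * r′) *ₗ u +ᴹ (x * s + y * s′) *ₗ v ∎)
    where
    open import Algebra.Properties.CommutativeSemigroup
      (CommutativeMonoid.commutativeSemigroup +ᴹ-commutativeMonoid) using (interchange)
    scale : ∀ x r s → x *ₗ (r *ₗ u +ᴹ s *ₗ v) ≈ᴹ (x * r) *ₗ u +ᴹ (x * s) *ₗ v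
    scale x r s = ≈ᴹ-trans (*ₗ-distribˡ x _ _)
      (+ᴹ-cong (≈ᴹ-sym (*ₗ-assoc x r u)) (≈ᴹ-sym (*ₗ-assoc x s v)))

  Plane-left : ∀ {u v} → Plane u v u
  Plane-left {u} {v} = 1# , 0# , (begin
    u                       ≈⟨ +ᴹ-identityʳ u ⟨
    u +ᴹ 0ᴹ                 ≈⟨ +ᴹ-cong (*ₗ-identityˡ u) (*ₗ-zeroˡ v) ⟨
    1# *ₗ u +ᴹ 0# *ₗ v      ∎)

  -- Divide by `s`: `v` is the inverse of `s` times `w - r u`. This is the basic move of an
  -- exchange.
  Plane-solve : ∀ {u v w r s} → ¬ s ≈ 0# → w ≈ᴹ r *ₗ u +ᴹ s *ₗ v → Plane u w v
  Plane-solve {u} {v} {w} {r} {s} s≉0 w≈ = t * (- r) , t , (begin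
    v                              ≈⟨ invert s≉0 sv≈ ⟩
    t *ₗ ((- r) *ₗ u +ᴹ w)         ≈⟨ *ₗ-distribˡ t _ w ⟩
    t *ₗ (- r) *ₗ u +ᴹ t *ₗ w      ≈⟨ +ᴹ-congʳ (*ₗ-assoc t (- r) u) ⟨
    (t * (- r)) *ₗ u +ᴹ t *ₗ w     ∎)
    where
    t = proj₁ (inverse s≉0)
    sv≈ : s *ₗ v ≈ᴹ (- r) *ₗ u +ᴹ w
    sv≈ = begin
      s *ₗ v                                    ≈⟨ +ᴹ-identityˡ _ ⟨
      0ᴹ +ᴹ s *ₗ v                              ≈⟨ +ᴹ-congʳ (-ᴹ‿inverseˡ _) ⟨
      (-ᴹ (r *ₗ u) +ᴹ r *ₗ u) +ᴹ s *ₗ v         ≈⟨ +ᴹ-assoc _ _ _ ⟩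
      -ᴹ (r *ₗ u) +ᴹ (r *ₗ u +ᴹ s *ₗ v)         ≈⟨ +ᴹ-cong (-‿distribˡ-*ₗ M r u) w≈ ⟨
      (- r) *ₗ u +ᴹ w                           ∎

  private
    zeroʳ-term : ∀ {u v w r s} → s ≈ 0# → w ≈ᴹ r *ₗ u +ᴹ s *ₗ v → w ≈ᴹ r *ₗ u
    zeroʳ-term {u} {v} {w} {r} {s} s≈0 w≈ = begin
      w                   ≈⟨ w≈ ⟩
      r *ₗ u +ᴹ s *ₗ v    ≈⟨ +ᴹ-congˡ (*ₗ-congʳ s≈0) ⟩
      r *ₗ u +ᴹ 0# *ₗ v   ≈⟨ +ᴹ-congˡ (*ₗ-zeroˡ v) ⟩
      r *ₗ u +ᴹ 0ᴹ        ≈⟨ +ᴹ-identityʳ _ ⟩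
      r *ₗ u              ∎

  private
    Plane-replaceʳ : ∀ {u v g} → ¬ Line u v → Plane u g v → Plane u v g
    Plane-replaceʳ {u} {v} v∉u (x , y , v≈) with y ≟ 0#
    ... | yes y≈0 = contradiction (x , zeroʳ-term y≈0 v≈) v∉u
    ... | no  y≉0 = Plane-solve y≉0 v≈

    -- Here `f` is already spanned by `e` and `u`, so `u` and `e` span the plane. Being off the line
    -- of `u`, the vector `v` then takes the place of `e`.
    Plane-exchange′ : ∀ {e f u v} → ¬ Line u v → Plane e u f →
                      Plane e f v → ∀ {w} → Plane e f w → Plane u v w
    Plane-exchange′ {e} {f} {u} v∉u f∈ v∈ w∈ =
      Plane-trans Plane-left (Plane-replaceʳ v∉u (into v∈)) (into w∈)
      where
      into : ∀ {w} → Plane e f w → Plane u e w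
      into w∈ = Plane-swap (Plane-trans Plane-left f∈ w∈)

  -- Steinitz exchange in dimension two: first u replaces one of e and f,
  -- then v the other one.
  Plane-exchange : ∀ {e f u v} → ¬ u ≈ᴹ 0ᴹ → ¬ Line u v →
                   Plane e f u → Plane e f v → ∀ {w} → Plane e f w → Plane u v w
  Plane-exchange {e} {f} {u} {v} u≉0 v∉u u∈@(r , s , u≈) v∈ w∈ with s ≟ 0#
  ... | no  s≉0 = Plane-exchange′ v∉u (Plane-solve s≉0 u≈) v∈ w∈
  ... | yes s≈0 = Plane-exchange′ v∉u
    (Plane-solve r≉0 (≈ᴹ-trans u≈ (+ᴹ-comm _ _))) (Plane-swap v∈) (Plane-swap w∈)
    where
    r≉0 : ¬ r ≈ 0#
    r≉0 r≈0 = u≉0 (begin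
      u         ≈⟨ zeroʳ-term s≈0 u≈ ⟩
      r *ₗ e    ≈⟨ *ₗ-congʳ r≈0 ⟩
      0# *ₗ e   ≈⟨ *ₗ-zeroˡ e ⟩
      0ᴹ        ∎)

  -- If `s` and `s′` differed, dividing `eq′` by `s - s′` would put `v` on the line of `u`. What
  -- remains is cancelled at `u`.
  Plane-unique : ∀ {u v r s r′ s′} → ¬ u ≈ᴹ 0ᴹ → ¬ v ≈ᴹ 0ᴹ → ¬ Line u v →
                 r *ₗ u +ᴹ s *ₗ v ≈ᴹ r′ *ₗ u +ᴹ s′ *ₗ v → r ≈ r′ × s ≈ s′
  Plane-unique {u} {v} {r} {s} {r′} {s′} u≉0 v≉0 v∉u eq = r≈r′ , s≈s′
    where
    eq′ : (s - s′) *ₗ v ≈ᴹ (r′ - r) *ₗ u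
    eq′ = begin
      (s - s′) *ₗ v                               ≈⟨ difference s s′ v ⟩
      s *ₗ v +ᴹ -ᴹ (s′ *ₗ v)                      ≈⟨ +ᴹ-congʳ (solve eq) ⟩
      (-ᴹ (r *ₗ u) +ᴹ (r′ *ₗ u +ᴹ s′ *ₗ v)) +ᴹ -ᴹ (s′ *ₗ v) ≈⟨ +ᴹ-assoc _ _ _ ⟩
      -ᴹ (r *ₗ u) +ᴹ ((r′ *ₗ u +ᴹ s′ *ₗ v) +ᴹ -ᴹ (s′ *ₗ v)) ≈⟨ +ᴹ-congˡ (+ᴹ-assoc _ _ _) ⟩
      -ᴹ (r *ₗ u) +ᴹ (r′ *ₗ u +ᴹ (s′ *ₗ v +ᴹ -ᴹ (s′ *ₗ v))) ≈⟨ +ᴹ-congˡ (+ᴹ-congˡ (-ᴹ‿inverseʳ _)) ⟩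
      -ᴹ (r *ₗ u) +ᴹ (r′ *ₗ u +ᴹ 0ᴹ)              ≈⟨ +ᴹ-congˡ (+ᴹ-identityʳ _) ⟩
      -ᴹ (r *ₗ u) +ᴹ r′ *ₗ u                      ≈⟨ +ᴹ-comm _ _ ⟩
      r′ *ₗ u +ᴹ -ᴹ (r *ₗ u)                      ≈⟨ difference r′ r u ⟨
      (r′ - r) *ₗ u                               ∎
      where
      difference : ∀ x y w → (x - y) *ₗ w ≈ᴹ x *ₗ w +ᴹ -ᴹ (y *ₗ w)
      difference x y w = ≈ᴹ-trans (*ₗ-distribʳ w x (- y)) (+ᴹ-congˡ (-‿distribˡ-*ₗ M y w))
      solve : ∀ {x y z} → x +ᴹ y ≈ᴹ z → y ≈ᴹ -ᴹ x +ᴹ z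
      solve {x} {y} {z} x+y≈z = begin
        y                   ≈⟨ +ᴹ-identityˡ y ⟨
        0ᴹ +ᴹ y             ≈⟨ +ᴹ-congʳ (-ᴹ‿inverseˡ x) ⟨
        (-ᴹ x +ᴹ x) +ᴹ y    ≈⟨ +ᴹ-assoc _ x y ⟩
        -ᴹ x +ᴹ (x +ᴹ y)    ≈⟨ +ᴹ-congˡ x+y≈z ⟩
        -ᴹ x +ᴹ z           ∎
    s≈s′ : s ≈ s′
    s≈s′ with s - s′ ≟ 0#
    ... | yes s-s′≈0 = x∙y⁻¹≈ε⇒x≈y s s′ s-s′≈0
      where open AbelianGroupProperties +-abelianGroup
    ... | no s-s′≉0 = contradiction
      (_ , ≈ᴹ-trans (invert s-s′≉0 eq′) (≈ᴹ-sym (*ₗ-assoc _ _ u))) v∉u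
    r≈r′ : r ≈ r′
    r≈r′ = *ₗ-cancelʳ u≉0 (G.∙-cancelʳ (s *ₗ v) (r *ₗ u) (r′ *ₗ u)
      (≈ᴹ-trans eq (+ᴹ-congˡ (*ₗ-congʳ (sym s≈s′)))))

  linearCombinations≅ : ∀ {d} {e : Vector Carrierᴹ d} → LinearlyIndependent M e →
    (∀ v → Span M e v) → Inverse (LeftModule.≈ᴹ-setoid (coordinateSpace R d)) ≈ᴹ-setoid
  linearCombinations≅ {d} {e} indep spans = record
    { to        = λ x → linearCombination M x e
    ; from      = proj₁ ∘ spans
    ; to-cong   = linearCombination-cong M e
    ; from-cong = λ {u} {v} u≈v → linearCombination-injective M indep
        (≈ᴹ-trans (≈ᴹ-sym (proj₂ (spans u))) (≈ᴹ-trans u≈v (proj₂ (spans v))))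
    ; inverse   = (λ {v} x≈ → ≈ᴹ-trans (linearCombination-cong M e x≈) (≈ᴹ-sym (proj₂ (spans v))))
                , (λ {x} {v} v≈ → linearCombination-injective M indep
                    (≈ᴹ-trans (≈ᴹ-sym (proj₂ (spans v))) v≈))
    }

  module _ {k : ℕ} (M-size : HasSize ≈ᴹ-setoid k) where
    private
      module F = Finite ≈ᴹ-setoid M-size

    -- Only `q ^ d` coefficient vectors have to be tried.
    Span? : ∀ {d} (e : Vector Carrierᴹ d) v → Dec (Span M e v)
    Span? {d} e v = search
      (λ x≈y v≈ → ≈ᴹ-trans v≈ (linearCombination-cong M e x≈y))
      (λ x → v F.≟ linearCombination M x e)
      where open Finite _ (coordinateSpaceSize R d size) using (search)

    -- A relation with nonzero leading coefficient could be solved for `v`, which would then lie in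
    -- the span of `e`.
    independent-∷ : ∀ {d} {e : Vector Carrierᴹ d} → LinearlyIndependent M e →
      ∀ {v} → ¬ Span M e v → LinearlyIndependent M (v ∷ e)
    independent-∷ {e = e} indep {v} v∉ x x≈0 with x zero ≟ 0#
    ... | yes x₀≈0 = λ { zero → x₀≈0 ; (suc i) → indep (tail x) tail≈0 i }
      where
      w = linearCombination M (tail x) e
      tail≈0 : w ≈ᴹ 0ᴹ
      tail≈0 = begin
        w                      ≈⟨ +ᴹ-identityˡ w ⟨
        0ᴹ +ᴹ w                ≈⟨ +ᴹ-congʳ (*ₗ-zeroˡ v) ⟨
        0# *ₗ v +ᴹ w           ≈⟨ +ᴹ-congʳ (*ₗ-congʳ x₀≈0) ⟨
        x zero *ₗ v +ᴹ w       ≈⟨ x≈0 ⟩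
        0ᴹ                     ∎
    ... | no x₀≉0 = contradiction ((λ i → s * (- 1# * x (suc i))) , (begin
        v                                  ≈⟨ invert x₀≉0 (G.inverseˡ-unique _ w x≈0) ⟩
        s *ₗ (-ᴹ w)                        ≈⟨ *ₗ-congˡ (-ᴹ‿cong (*ₗ-identityˡ w)) ⟨
        s *ₗ (-ᴹ (1# *ₗ w))                ≈⟨ *ₗ-congˡ (-‿distribˡ-*ₗ M 1# w) ⟨
        s *ₗ (- 1#) *ₗ w                   ≈⟨ *ₗ-congˡ (linearCombination-* M (- 1#) (tail x) e) ⟨
        s *ₗ linearCombination M (λ i → - 1# * x (suc i)) e
          ≈⟨ linearCombination-* M s _ e ⟨
        linearCombination M (λ i → s * (- 1# * x (suc i))) e ∎)) v∉
      where
      w = linearCombination M (tail x) e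
      s = proj₁ (inverse x₀≉0)

    -- Distinct coefficient vectors give distinct combinations, so `q ^ d ≤ k`, while `d < q ^ d`.
    independent⇒< : ∀ {d} {e : Vector Carrierᴹ d} → LinearlyIndependent M e → d < k
    independent⇒< {d} {e} indep = ℕ.<-≤-trans (n<m^n 1<q d)
      (injective⇒≤ {f = λ i → M.to (linearCombination M (C.from i) e)} λ eq →
        C.injective (linearCombination-injective M indep (M.injective eq)))
      where
      module M where
        open Inverse M-size public
        open Injection (Inverse⇒Injection M-size) public using (injective)
      module C where
        open Inverse (coordinateSpaceSize R d size) public
        open Injection (Inverse⇒Injection (Inv.sym (coordinateSpaceSize R d size))) public using (injective)

    ∃basis : ∃[ d ] ∃[ e ] LinearlyIndependent M {d} e × (∀ v → Span M e v)
    ∃basis = extend k (λ ()) (λ _ _ ()) (ℕ.m≤m+n k 0)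
      where
      -- The invariant `k ≤ fuel +ℕ d` makes exhausted fuel contradict `independent⇒<`.
      extend : ∀ fuel {d} (e : Vector Carrierᴹ d) → LinearlyIndependent M e → k ≤ fuel +ℕ d →
               ∃[ d ] ∃[ e ] LinearlyIndependent M {d} e × (∀ v → Span M e v)
      extend zero       e indep k≤d = contradiction (independent⇒< indep) (ℕ.≤⇒≯ k≤d)
      extend (suc fuel) {d} e indep k≤
        with F.search-counterexample (λ { u≈v (x , u≈) → x , ≈ᴹ-trans (≈ᴹ-sym u≈v) u≈ }) (Span? e)
      ... | inj₂ spans    = _ , e , indep , spans
      ... | inj₁ (v , v∉) = extend fuel (v ∷ e) (independent-∷ indep v∉)
        (ℕ.≤-trans k≤ (ℕ.≤-reflexive (≡.sym (ℕ.+-suc fuel d))))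

    -- Every dimension in the proof is identified through this count, by comparing exponents of a
    -- number greater than 1.
    basis-size : ∀ {d} {e : Vector Carrierᴹ d} → LinearlyIndependent M e →
                 (∀ v → Span M e v) → k ≡ q ^ d
    basis-size {d} indep spans = HasSize-unique M-size
      (Comp.inverse (Inv.sym (linearCombinations≅ indep spans)) (coordinateSpaceSize R d size))

  -- A nonzero `u` is a multiple of the single basis vector by an invertible scalar, so it spans as
  -- well. It is applied with `u` the unit of a field.
  one-dimensional : ∀ {u v} {e : Vector Carrierᴹ 1} → (∀ v → Span M e v) →
                    ¬ u ≈ᴹ 0ᴹ → Line u v
  one-dimensional {u} {v} {e} spans u≉0 = Line-trans (Line-sym u≉0 (on-e u)) (on-e v)
    where
    on-e : ∀ w → Line (e zero) w
    on-e w with x , w≈ ← spans w = x zero , ≈ᴹ-trans w≈ (+ᴹ-identityʳ _)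

^-injectiveʳ : ∀ {m} → 1 < m → ∀ {i j} → m ^ i ≡ m ^ j → i ≡ j
^-injectiveʳ {m} 1<m {i} {j} eq with ℕ.<-cmp i j
... | tri< i<j _ _ = contradiction eq (ℕ.<⇒≢ (ℕ.^-monoʳ-< m 1<m i<j))
... | tri≈ _ i≡j _ = i≡j
... | tri> _ _ i>j = contradiction (≡.sym eq) (ℕ.<⇒≢ (ℕ.^-monoʳ-< m 1<m i>j))

-- From `x` not being zero, tightness yields only that `x` cannot fail to be apart from zero. The
-- inverse is therefore searched for, and apartness merely refutes that the search fails.
finiteField⇒divisionRing : ∀ {q} (F : FiniteField c ℓ₁ ℓ₂ q) →
                           FiniteDivisionRing (FiniteField.ring F) q
finiteField⇒divisionRing F = record
  { size    = hasSize
  ; 1≉0     = λ 1≈0 → #-irrefl 1≈0 1#0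
  ; inverse = inverse
  }
  where
  open FiniteField F
  open HeytingProperties heytingCommutativeRing using (1#0; x-0≈x)
  open Finite setoid hasSize
  inverse : ∀ {x} → ¬ x ≈ 0# → ∃[ y ] y * x ≈ 1#
  inverse {x} x≉0 with search (λ y≈z yx≈1 → trans (*-congʳ (sym y≈z)) yx≈1) (λ y → y * x ≟ 1#)
  ... | yes inv = inv
  ... | no ¬inv = contradiction (proj₁ (tight x 0#) λ x#0 →
    let y , y[x-0]≈1 , _ = #⇒invertible x#0
    in ¬inv (y , trans (*-congˡ (sym (x-0≈x x))) y[x-0]≈1)) x≉0

-- Subrings and submodules

record IsSubring (R : Ring c ℓ) (P : Pred (Ring.Carrier R) p) : Set (c ⊔ ℓ ⊔ p) where
  open Ring R
  field
    +-closed : ∀ {x y} → x ∈ P → y ∈ P → x + y ∈ P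
    *-closed : ∀ {x y} → x ∈ P → y ∈ P → x * y ∈ P
    -‿closed : ∀ {x} → x ∈ P → - x ∈ P
    0-closed : 0# ∈ P
    1-closed : 1# ∈ P

module Subring {R : Ring c ℓ} {P : Pred (Ring.Carrier R) p} (P-subring : IsSubring R P) where
  open Ring R
  open IsSubring P-subring

  -- Equality ignores the membership proofs, so `proj₁` is a monomorphism by definition and the ring
  -- laws are pulled back along it.
  subrawring : RawRing (c ⊔ p) ℓ
  subrawring = record
    { Carrier = ∃ P
    ; _≈_     = λ x y → proj₁ x ≈ proj₁ y
    ; _+_     = λ (x , x∈) (y , y∈) → x + y , +-closed x∈ y∈
    ; _*_     = λ (x , x∈) (y , y∈) → x * y , *-closed x∈ y∈
    ; -_      = λ (x , x∈) → - x , -‿closed x∈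
    ; 0#      = 0# , 0-closed
    ; 1#      = 1# , 1-closed
    }

  open RingMorphisms subrawring rawRing

  inclusion : IsRingMonomorphism proj₁
  inclusion = record
    { isRingHomomorphism = record
      { isSemiringHomomorphism = record
        { isNearSemiringHomomorphism = record
          { +-isMonoidHomomorphism = record
            { isMagmaHomomorphism = record
              { isRelHomomorphism = record { cong = id }
              ; homo = λ _ _ → refl
              }
            ; ε-homo = refl
            }
          ; *-homo = λ _ _ → refl
          }
        ; 1#-homo = refl
        }
      ; -‿homo = λ _ → refl
      }
    ; injective = id
    }

  subring : Ring (c ⊔ p) ℓ
  subring = record { isRing = RingMonomorphism.isRing inclusion isRing }

  inclusion-isRingHomomorphism :
    RingMorphisms.IsRingHomomorphism (Ring.rawRing subring) rawRing proj₁
  inclusion-isRingHomomorphism = IsRingMonomorphism.isRingHomomorphism inclusion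

module _ {R : Ring c ℓ} (M : LeftModule R μ ℓμ) where
  open Ring R using (1#; isRing) renaming (-_ to -ᴿ_)
  open LeftModule M

  submodule : ∀ {P : Pred Carrierᴹ p} → IsSubmodule M P → LeftModule R (μ ⊔ p) ℓμ
  submodule {P = P} P-submodule = record
    { isLeftModule = LeftModuleMonomorphism.isLeftModule inclusion isRing isLeftModule }
    where
    open IsSubmodule P-submodule
    -- `IsSubmodule` does not list negation, which is multiplication by minus one.
    -ᴹ-closed : ∀ {v} → v ∈ P → -ᴹ v ∈ P
    -ᴹ-closed {v} v∈ = resp
      (≈ᴹ-trans (-‿distribˡ-*ₗ M 1# v) (-ᴹ‿cong (*ₗ-identityˡ v)))
      (*ₗ-closed (-ᴿ 1#) v∈)
    raw : RawLeftModule _ _ _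
    raw = record
      { Carrierᴹ = ∃ P
      ; _≈ᴹ_     = λ u v → proj₁ u ≈ᴹ proj₁ v
      ; _+ᴹ_     = λ (u , u∈) (v , v∈) → u +ᴹ v , +ᴹ-closed u∈ v∈
      ; _*ₗ_     = λ r (v , v∈) → r *ₗ v , *ₗ-closed r v∈
      ; 0ᴹ       = 0ᴹ , 0ᴹ-closed
      ; -ᴹ_      = λ (v , v∈) → -ᴹ v , -ᴹ-closed v∈
      }
    open LeftModuleMorphisms raw rawLeftModule
    inclusion : IsLeftModuleMonomorphism proj₁
    inclusion = record
      { isLeftModuleHomomorphism = record
        { +ᴹ-isGroupHomomorphism = record
          { isMonoidHomomorphism = record
            { isMagmaHomomorphism = record
              { isRelHomomorphism = record { cong = id }
              ; homo = λ _ _ → ≈ᴹ-refl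
              }
            ; ε-homo = ≈ᴹ-refl
            }
          ; ⁻¹-homo = λ _ → ≈ᴹ-refl
          }
        ; *ₗ-homo = λ _ _ → ≈ᴹ-refl
        }
      ; injective = id
      }

-- The vector space structure of a Desarguesian spread

module Spread {q} {F : FiniteField c ℓ₁ ℓ₂ q} {n} (E : Extension F n) {φ}
              (φ-iso : IsLinearIsomorphism F n E φ) where

  open Extension E using (embed; isRingHomomorphism)
  module K = FiniteField (Extension.top E)
  private
    module F = FiniteField F
    module φ = LeftModuleMorphisms.IsLeftModuleIsomorphism φ-iso
    module Pl = LeftModule (plane F n E)
    module V = LeftModule (V F n)
  open V using (_≈ᴹ_; _+ᴹ_; 0ᴹ; -ᴹ_; ≈ᴹ-refl; ≈ᴹ-sym; ≈ᴹ-trans)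

  K-division : FiniteDivisionRing K.ring (q ^ n)
  K-division = finiteField⇒divisionRing (Extension.top E)

  ψ : V.Carrierᴹ → Pl.Carrierᴹ
  ψ v = proj₁ (φ.surjective v)

  φψ : ∀ v → φ (ψ v) ≈ᴹ v
  φψ v = proj₂ (φ.surjective v) Pl.≈ᴹ-refl

  ψφ : ∀ w → ψ (φ w) Pl.≈ᴹ w
  ψφ w = φ.injective (φψ (φ w))

  ψ-cong : ∀ {u v} → u ≈ᴹ v → ψ u Pl.≈ᴹ ψ v
  ψ-cong {u} {v} u≈v = φ.injective (≈ᴹ-trans (φψ u) (≈ᴹ-trans u≈v (≈ᴹ-sym (φψ v))))

  ψ-+ : ∀ u v → ψ (u +ᴹ v) Pl.≈ᴹ ψ u Pl.+ᴹ ψ v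
  ψ-+ u v = φ.injective (≈ᴹ-trans (φψ (u +ᴹ v)) (≈ᴹ-sym
    (≈ᴹ-trans (φ.+ᴹ-homo (ψ u) (ψ v)) (V.+ᴹ-cong (φψ u) (φψ v)))))

  infixr 7 _•_
  _•_ : K.Carrier → V.Carrierᴹ → V.Carrierᴹ
  x • v = φ (x Pl.*ₗ ψ v)

  -- The equality and addition of `V` are kept and only the scalars change, so that the structures
  -- of two spreads live on one group and can be compared.
  VK : LeftModule K.ring c ℓ₁
  VK = record
    { Carrierᴹ     = V.Carrierᴹ
    ; _≈ᴹ_         = _≈ᴹ_
    ; _+ᴹ_         = _+ᴹ_
    ; _*ₗ_         = _•_
    ; 0ᴹ           = 0ᴹ
    ; -ᴹ_          = -ᴹ_
    ; isLeftModule = record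
      { isLeftSemimodule = record
        { +ᴹ-isCommutativeMonoid = V.+ᴹ-isCommutativeMonoid
        ; isPreleftSemimodule = record
          { *ₗ-cong      = λ x≈y u≈v → φ.⟦⟧-cong (Pl.*ₗ-cong x≈y (ψ-cong u≈v))
          ; *ₗ-zeroˡ     = λ v → ≈ᴹ-trans (φ.⟦⟧-cong (Pl.*ₗ-zeroˡ (ψ v))) φ.0ᴹ-homo
          ; *ₗ-distribʳ  = λ v x y → ≈ᴹ-trans
              (φ.⟦⟧-cong (Pl.*ₗ-distribʳ (ψ v) x y)) (φ.+ᴹ-homo _ _)
          ; *ₗ-identityˡ = λ v → ≈ᴹ-trans (φ.⟦⟧-cong (Pl.*ₗ-identityˡ (ψ v))) (φψ v)
          ; *ₗ-assoc     = λ x y v → φ.⟦⟧-cong (Pl.≈ᴹ-trans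
              (Pl.*ₗ-assoc x y (ψ v)) (Pl.*ₗ-congˡ (Pl.≈ᴹ-sym (ψφ (y Pl.*ₗ ψ v)))))
          ; *ₗ-zeroʳ     = λ x → ≈ᴹ-trans
              (φ.⟦⟧-cong (Pl.≈ᴹ-trans (Pl.*ₗ-congˡ ψ-0) (Pl.*ₗ-zeroʳ x))) φ.0ᴹ-homo
          ; *ₗ-distribˡ  = λ x u v → ≈ᴹ-trans
              (φ.⟦⟧-cong (Pl.≈ᴹ-trans (Pl.*ₗ-congˡ (ψ-+ u v)) (Pl.*ₗ-distribˡ x (ψ u) (ψ v))))
              (φ.+ᴹ-homo _ _)
          }
        }
      ; -ᴹ‿cong    = V.-ᴹ‿cong
      ; -ᴹ‿inverse = V.-ᴹ‿inverse
      }
    }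
    where
    ψ-0 : ψ 0ᴹ Pl.≈ᴹ Pl.0ᴹ
    ψ-0 = φ.injective (≈ᴹ-trans (φψ 0ᴹ) (≈ᴹ-sym φ.0ᴹ-homo))

  module VK = LeftModule VK
  open VectorSpace K-division VK public
  open ≈-Reasoning V.≈ᴹ-setoid

  -- This is the `F`-linearity of `φ`. It is what places `F` inside the common scalars of two
  -- spreads.
  embed-• : ∀ r v → embed r • v ≈ᴹ r V.*ₗ v
  embed-• r v = ≈ᴹ-trans (φ.*ₗ-homo r (ψ v)) (V.*ₗ-congˡ (φψ v))

  private
    φ-• : ∀ x w → φ (x Pl.*ₗ w) ≈ᴹ x • φ w
    φ-• x w = φ.⟦⟧-cong (Pl.*ₗ-congˡ (Pl.≈ᴹ-sym (ψφ w)))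

    e₀ e₁ : Pl.Carrierᴹ
    e₀ = K.1# ∷ K.0# ∷ []
    e₁ = K.0# ∷ K.1# ∷ []

    plane-spanned : ∀ v → Plane (φ e₀) (φ e₁) v
    plane-spanned v = w zero , w (suc zero) , (begin
      v                              ≈⟨ φψ v ⟨
      φ w                            ≈⟨ φ.⟦⟧-cong w≈ ⟩
      φ (w zero Pl.*ₗ e₀ Pl.+ᴹ w (suc zero) Pl.*ₗ e₁) ≈⟨ φ.+ᴹ-homo _ _ ⟩
      φ (w zero Pl.*ₗ e₀) +ᴹ φ (w (suc zero) Pl.*ₗ e₁) ≈⟨ V.+ᴹ-cong (φ-• _ _) (φ-• _ _) ⟩
      w zero • φ e₀ +ᴹ w (suc zero) • φ e₁ ∎)
      where
      w = ψ v
      w≈ : w Pl.≈ᴹ w zero Pl.*ₗ e₀ Pl.+ᴹ w (suc zero) Pl.*ₗ e₁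
      w≈ zero       = K.sym (K.trans (K.+-cong (K.*-identityʳ _) (K.zeroʳ _)) (K.+-identityʳ _))
      w≈ (suc zero) = K.sym (K.trans (K.+-cong (K.zeroʳ _) (K.*-identityʳ _)) (K.+-identityˡ _))

  -- The images of the two standard vectors span `V` over `K`, and `u` and `v` can be exchanged for
  -- them.
  decompose : ∀ {u v} → ¬ u ≈ᴹ 0ᴹ → ¬ Line u v → ∀ w → Plane u v w
  decompose u≉0 v∉u w =
    Plane-exchange u≉0 v∉u (plane-spanned _) (plane-spanned _) (plane-spanned w)

  Line-cong : ∀ {u v} → u ≈ᴹ v → Line u ⊆ Line v
  Line-cong u≈v (r , w≈) = r , ≈ᴹ-trans w≈ (VK.*ₗ-congˡ u≈v)

  private
    module PlaneLines = VectorSpace K-division (plane F n E)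

  Image-line : (P : Subspace (plane F n E) 1) →
               ∃[ u ] ¬ u ≈ᴹ 0ᴹ × Image F n E φ P ≐ Line u
  Image-line P = φ b , φb≉0 , to , from
    where
    open Subspace P
    b = basis zero
    -- Otherwise `b` would vanish, and the coefficient 1 would contradict its independence.
    φb≉0 : ¬ φ b ≈ᴹ 0ᴹ
    φb≉0 φb≈0 = FiniteDivisionRing.1≉0 K-division (independent (λ _ → K.1#)
      (Pl.≈ᴹ-trans (Pl.+ᴹ-identityʳ _) (Pl.≈ᴹ-trans (Pl.*ₗ-identityˡ b)
        (φ.injective (≈ᴹ-trans φb≈0 (≈ᴹ-sym φ.0ᴹ-homo))))) zero)
    to : Image F n E φ P ⊆ Line (φ b)
    to (w , w∈ , φw≈v) with x , w≈ ← spanning w∈ = x zero , ≈ᴹ-trans (≈ᴹ-sym φw≈v)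
      (≈ᴹ-trans (φ.⟦⟧-cong (Pl.≈ᴹ-trans w≈ (Pl.+ᴹ-identityʳ _))) (φ-• (x zero) b))
    from : Line (φ b) ⊆ Image F n E φ P
    from (x , v≈) = x Pl.*ₗ b , IsSubmodule.*ₗ-closed isSubmodule x (basis∈ zero)
                  , ≈ᴹ-trans (φ-• x b) (≈ᴹ-sym v≈)

  Line-image : ∀ {u} → ¬ u ≈ᴹ 0ᴹ → ∃[ P ] Line u ≐ Image F n E φ P
  Line-image {u} u≉0 = P , to , from
    where
    ψu≉0 : ¬ ψ u Pl.≈ᴹ Pl.0ᴹ
    ψu≉0 ψu≈0 = u≉0 (≈ᴹ-trans (≈ᴹ-sym (φψ u)) (≈ᴹ-trans (φ.⟦⟧-cong ψu≈0) φ.0ᴹ-homo))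
    P : Subspace (plane F n E) 1
    P = record
      { member      = PlaneLines.Line (ψ u)
      ; isSubmodule = PlaneLines.Line-isSubmodule (ψ u)
      ; basis       = λ _ → ψ u
      ; basis∈      = λ _ → PlaneLines.Line-refl
      ; independent = λ { x x≈0 zero → PlaneLines.*ₗ-cancelʳ ψu≉0
          (Pl.≈ᴹ-trans (Pl.≈ᴹ-sym (Pl.+ᴹ-identityʳ _)) (Pl.≈ᴹ-trans x≈0 (Pl.≈ᴹ-sym (Pl.*ₗ-zeroˡ (ψ u))))) }
      ; spanning    = λ (x , w≈) → (λ _ → x) , Pl.≈ᴹ-trans w≈ (Pl.≈ᴹ-sym (Pl.+ᴹ-identityʳ _))
      }
    to : Line u ⊆ Image F n E φ P
    to (x , v≈) = x Pl.*ₗ ψ u , (x , Pl.≈ᴹ-refl) , ≈ᴹ-sym v≈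
    from : Image F n E φ P ⊆ Line u
    from (w , (x , w≈) , φw≈v) = x , ≈ᴹ-trans (≈ᴹ-sym φw≈v) (φ.⟦⟧-cong w≈)

  K-over-F : LeftModule F.ring c ℓ₁
  K-over-F = restrictScalars embed isRingHomomorphism (TensorUnit.leftModule {R = K.ring})

  F-division : FiniteDivisionRing F.ring q
  F-division = finiteField⇒divisionRing F

  private
    module KF = VectorSpace F-division K-over-F

    -- `Extension` records only the order of `K`. A basis of some length `d` gives `q ^ n ≡ q ^ d`,
    -- which forces `d` to be `n`.
    K-basis : ∃[ e ] LinearlyIndependent K-over-F {n} e × (∀ v → Span K-over-F e v)
    K-basis with d , e , indep , spans ← KF.∃basis K.hasSize
      with ≡.refl ← ^-injectiveʳ (FiniteDivisionRing.1<q F-division) {n} {d}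
                      (KF.basis-size K.hasSize indep spans)
      = e , indep , spans

  -- An `F`-basis of `K` multiplied by `u` is an `F`-basis of the line, which therefore has the
  -- dimension `n` that `Space` asks for.
  lineSpace : ∀ u → ¬ u ≈ᴹ 0ᴹ → Space F n
  lineSpace u u≉0 = record
    { member      = Line u
    ; isSubmodule = record
      { resp      = resp
      ; 0ᴹ-closed = 0ᴹ-closed
      ; +ᴹ-closed = +ᴹ-closed
      ; *ₗ-closed = λ r v∈ → resp (embed-• r _) (*ₗ-closed (embed r) v∈)
      }
    ; basis       = λ i → e i • u
    ; basis∈      = λ i → e i , ≈ᴹ-refl
    ; independent = λ x x≈0 → indep x (*ₗ-cancelʳ u≉0
        (≈ᴹ-trans (scaled-combination x) (≈ᴹ-trans x≈0 (≈ᴹ-sym (VK.*ₗ-zeroˡ u)))))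
    ; spanning    = λ (k , v≈) → let x , k≈ = spans k in
        x , ≈ᴹ-trans v≈ (≈ᴹ-trans (VK.*ₗ-congʳ k≈) (scaled-combination x))
    }
    where
    open IsSubmodule (Line-isSubmodule u)
    e = proj₁ K-basis
    indep = proj₁ (proj₂ K-basis)
    spans = proj₂ (proj₂ K-basis)
    scaled-combination : ∀ x → linearCombination K-over-F x e • u ≈ᴹ
                               linearCombination (V F n) x (λ i → e i • u)
    scaled-combination x = linearCombination-map K-over-F (V F n) (_• u)
      (VK.*ₗ-zeroˡ u) (λ k l → VK.*ₗ-distribʳ u k l)
      (λ r k → ≈ᴹ-trans (VK.*ₗ-assoc (embed r) k u) (embed-• r (k • u))) x e

  module _ {D : Pred (Space F n) p}
           (D-spread : ∀ S → S ∈ D ⇔ (∃[ P ] Subspace.member S ≐ Image F n E φ P)) where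

    ∈spread⇒line : ∀ {S} → S ∈ D → ∃[ u ] ¬ u ≈ᴹ 0ᴹ × Subspace.member S ≐ Line u
    ∈spread⇒line {S} S∈D with P , S≐ ← Equivalence.to (D-spread S) S∈D
      with u , u≉0 , P≐ ← Image-line P = u , u≉0 , ≐-trans S≐ P≐

    line⇒∈spread : ∀ {S u} → ¬ u ≈ᴹ 0ᴹ → Subspace.member S ≐ Line u → S ∈ D
    line⇒∈spread {S} u≉0 S≐ with P , ≐P ← Line-image u≉0 =
      Equivalence.from (D-spread S) (P , ≐-trans S≐ ≐P)

  Line-≐ : ∀ {u v} → ¬ v ≈ᴹ 0ᴹ → Line u v → Line u ≐ Line v
  Line-≐ v≉0 v∈u = Line-trans (Line-sym v≉0 v∈u) , Line-trans v∈u

  line-through : ∀ {S : Pred V.Carrierᴹ (c ⊔ ℓ₁)} {u v} → S ≐ Line u → ¬ v ≈ᴹ 0ᴹ → v ∈ S → S ≐ Line v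
  line-through S≐u v≉0 v∈S = ≐-trans S≐u (Line-≐ v≉0 (proj₁ S≐u v∈S))

-- Scalars common to two spreads

module TwoSpreads {q n} {F : FiniteField c ℓ₁ ℓ₂ q}
                  (E₁ : Extension F n) {φ₁} (φ₁-iso : IsLinearIsomorphism F n E₁ φ₁)
                  (E₂ : Extension F n) {φ₂} (φ₂-iso : IsLinearIsomorphism F n E₂ φ₂) where

  module S₁ = Spread E₁ φ₁-iso
  module S₂ = Spread E₂ φ₂-iso
  open S₁ using () renaming (_•_ to infixr 7 _•₁_)
  open S₂ using () renaming (_•_ to infixr 7 _•₂_)
  module K₁ = S₁.K
  module K₂ = S₂.K
  private
    module V₁ = S₁.VK
    module V₂ = S₂.VK

  open LeftModule (V F n) using
    ( Carrierᴹ; _≈ᴹ_; _+ᴹ_; 0ᴹ; ≈ᴹ-refl; ≈ᴹ-sym; ≈ᴹ-trans; ≈ᴹ-setoid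
    ; +ᴹ-cong; +ᴹ-congˡ )
  open ≈-Reasoning ≈ᴹ-setoid

  infix 4 _~_
  -- Elements of the two fields can only be compared as operators on `V`.
  _~_ : K₁.Carrier → K₂.Carrier → Set (c ⊔ ℓ₁)
  k ~ k′ = ∀ v → k •₁ v ≈ᴹ k′ •₂ v

  -- A projective frame of the line over `K₁`: in coordinates with respect to `a` and `b`, the
  -- points (1,0), (0,1) and (1,1) are elements of both spreads.
  record Frame (a b : Carrierᴹ) : Set (c ⊔ ℓ₁) where
    field
      a≉0   : ¬ a ≈ᴹ 0ᴹ
      b≉0   : ¬ b ≈ᴹ 0ᴹ
      b∉a   : ¬ S₁.Line a b
      a≐    : S₁.Line a ≐ S₂.Line a
      b≐    : S₁.Line b ≐ S₂.Line b
      a+b≐  : S₁.Line (a +ᴹ b) ≐ S₂.Line (a +ᴹ b)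

    b∉₂a : ¬ S₂.Line a b
    b∉₂a = b∉a ∘ proj₂ a≐

  module _ {a b} (frame : Frame a b) where
    open Frame frame

    -- Comparing z (a + b) with its a and b components shows that z acts on
    -- a and on b as one and the same scalar of the other field.
    transfer : ∀ z → ∃[ z′ ] z •₁ a ≈ᴹ z′ •₂ a × z •₁ b ≈ᴹ z′ •₂ b
    transfer z
      with α , za≈ ← proj₁ a≐ (z , ≈ᴹ-refl)
         | β , zb≈ ← proj₁ b≐ (z , ≈ᴹ-refl)
         | z′ , z[a+b]≈ ← proj₁ a+b≐ (z , ≈ᴹ-refl)
      with α≈z′ , β≈z′ ← S₂.Plane-unique a≉0 b≉0 b∉₂a (begin
        α •₂ a +ᴹ β •₂ b      ≈⟨ +ᴹ-cong za≈ zb≈ ⟨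
        z •₁ a +ᴹ z •₁ b      ≈⟨ V₁.*ₗ-distribˡ z a b ⟨
        z •₁ (a +ᴹ b)         ≈⟨ z[a+b]≈ ⟩
        z′ •₂ (a +ᴹ b)        ≈⟨ V₂.*ₗ-distribˡ z′ a b ⟩
        z′ •₂ a +ᴹ z′ •₂ b    ∎)
      = z′ , ≈ᴹ-trans za≈ (V₂.*ₗ-congʳ α≈z′) , ≈ᴹ-trans zb≈ (V₂.*ₗ-congʳ β≈z′)

    -- Write `z′` for the transfer of `z`. As `z (a + k b)` is a `K₂`-multiple `ζ` of `a + k b`, its
    -- `a`-coordinate gives `ζ = z′` and its `b`-coordinate gives `(k z)′ = ζ k′`. Hence `k` acts as
    -- `k′` on all multiples `z a` and `z b`, and these span `V`.
    slope-commutes : ∀ {k} → S₁.Line (a +ᴹ k •₁ b) ⊆ S₂.Line (a +ᴹ k •₁ b) → ∃[ k′ ] k ~ k′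
    slope-commutes {k} u⊆ with k′ , ka≈ , kb≈ ← transfer k = k′ , k~k′
      where
      on-lines : ∀ z → k •₁ z •₁ a ≈ᴹ k′ •₂ z •₁ a × k •₁ z •₁ b ≈ᴹ k′ •₂ z •₁ b
      on-lines z
        with z′ , za≈ , zb≈ ← transfer z
           | κ , kza≈ , kzb≈ ← transfer (k K₁.* z)
           | ζ , zu≈ ← u⊆ (z , ≈ᴹ-refl)
        with z′≈ζ , κ≈ζk′ ← S₂.Plane-unique a≉0 b≉0 b∉₂a (begin
          z′ •₂ a +ᴹ κ •₂ b             ≈⟨ +ᴹ-cong za≈ kzb≈ ⟨
          z •₁ a +ᴹ (k K₁.* z) •₁ b     ≈⟨ +ᴹ-congˡ (V₁.*ₗ-congʳ (K₁.*-comm k z)) ⟩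
          z •₁ a +ᴹ (z K₁.* k) •₁ b     ≈⟨ +ᴹ-congˡ (V₁.*ₗ-assoc z k b) ⟩
          z •₁ a +ᴹ z •₁ k •₁ b         ≈⟨ V₁.*ₗ-distribˡ z a _ ⟨
          z •₁ (a +ᴹ k •₁ b)            ≈⟨ zu≈ ⟩
          ζ •₂ (a +ᴹ k •₁ b)            ≈⟨ V₂.*ₗ-congˡ (+ᴹ-congˡ kb≈) ⟩
          ζ •₂ (a +ᴹ k′ •₂ b)           ≈⟨ V₂.*ₗ-distribˡ ζ a _ ⟩
          ζ •₂ a +ᴹ ζ •₂ k′ •₂ b        ≈⟨ +ᴹ-congˡ (V₂.*ₗ-assoc ζ k′ b) ⟨
          ζ •₂ a +ᴹ (ζ K₂.* k′) •₂ b    ∎)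
        = on za≈ kza≈ , on zb≈ kzb≈
        where
        κ≈ : κ K₂.≈ k′ K₂.* z′
        κ≈ = K₂.trans κ≈ζk′ (K₂.trans (K₂.*-comm ζ k′) (K₂.*-congˡ (K₂.sym z′≈ζ)))
        on : ∀ {v} → z •₁ v ≈ᴹ z′ •₂ v → (k K₁.* z) •₁ v ≈ᴹ κ •₂ v →
             k •₁ z •₁ v ≈ᴹ k′ •₂ z •₁ v
        on {v} zv≈ kzv≈ = begin
          k •₁ z •₁ v            ≈⟨ V₁.*ₗ-assoc k z v ⟨
          (k K₁.* z) •₁ v        ≈⟨ kzv≈ ⟩
          κ •₂ v                 ≈⟨ V₂.*ₗ-congʳ κ≈ ⟩
          (k′ K₂.* z′) •₂ v      ≈⟨ V₂.*ₗ-assoc k′ z′ v ⟩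
          k′ •₂ z′ •₂ v          ≈⟨ V₂.*ₗ-congˡ zv≈ ⟨
          k′ •₂ z •₁ v           ∎
      k~k′ : k ~ k′
      k~k′ v with x , y , v≈ ← S₁.decompose a≉0 b∉a v = begin
        k •₁ v                              ≈⟨ V₁.*ₗ-congˡ v≈ ⟩
        k •₁ (x •₁ a +ᴹ y •₁ b)             ≈⟨ V₁.*ₗ-distribˡ k _ _ ⟩
        k •₁ x •₁ a +ᴹ k •₁ y •₁ b          ≈⟨ +ᴹ-cong (proj₁ (on-lines x)) (proj₂ (on-lines y)) ⟩
        k′ •₂ x •₁ a +ᴹ k′ •₂ y •₁ b        ≈⟨ V₂.*ₗ-distribˡ k′ _ _ ⟨
        k′ •₂ (x •₁ a +ᴹ y •₁ b)            ≈⟨ V₂.*ₗ-congˡ v≈ ⟨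
        k′ •₂ v                             ∎

    -- The `K₂`-scalar for `z` is its transfer `z′`. By commutativity `k` acts last, on `z b`, where
    -- it may be replaced by `k′`; commutativity of `K₂` then lets `z′` be factored out.
    commutes⇒slope : ∀ {k k′} → k ~ k′ → S₁.Line (a +ᴹ k •₁ b) ⊆ S₂.Line (a +ᴹ k •₁ b)
    commutes⇒slope {k} {k′} k~k′ {v} (z , v≈) with z′ , za≈ , zb≈ ← transfer z = z′ , (begin
      v                                 ≈⟨ v≈ ⟩
      z •₁ (a +ᴹ k •₁ b)                ≈⟨ V₁.*ₗ-distribˡ z a _ ⟩
      z •₁ a +ᴹ z •₁ k •₁ b             ≈⟨ +ᴹ-congˡ (V₁.*ₗ-assoc z k b) ⟨
      z •₁ a +ᴹ (z K₁.* k) •₁ b         ≈⟨ +ᴹ-cong za≈ (V₁.*ₗ-congʳ (K₁.*-comm z k)) ⟩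
      z′ •₂ a +ᴹ (k K₁.* z) •₁ b        ≈⟨ +ᴹ-congˡ (V₁.*ₗ-assoc k z b) ⟩
      z′ •₂ a +ᴹ k •₁ z •₁ b            ≈⟨ +ᴹ-congˡ (k~k′ (z •₁ b)) ⟩
      z′ •₂ a +ᴹ k′ •₂ z •₁ b           ≈⟨ +ᴹ-congˡ (V₂.*ₗ-congˡ zb≈) ⟩
      z′ •₂ a +ᴹ k′ •₂ z′ •₂ b          ≈⟨ +ᴹ-congˡ (V₂.*ₗ-assoc k′ z′ b) ⟨
      z′ •₂ a +ᴹ (k′ K₂.* z′) •₂ b      ≈⟨ +ᴹ-congˡ (V₂.*ₗ-congʳ (K₂.*-comm k′ z′)) ⟩
      z′ •₂ a +ᴹ (z′ K₂.* k′) •₂ b      ≈⟨ +ᴹ-congˡ (V₂.*ₗ-assoc z′ k′ b) ⟩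
      z′ •₂ a +ᴹ z′ •₂ k′ •₂ b          ≈⟨ V₂.*ₗ-distribˡ z′ a _ ⟨
      z′ •₂ (a +ᴹ k′ •₂ b)              ≈⟨ V₂.*ₗ-congˡ (+ᴹ-congˡ (k~k′ b)) ⟨
      z′ •₂ (a +ᴹ k •₁ b)               ∎)

-- The common subfield and its degree

module CommonSubfield {q n} {F : FiniteField c ℓ₁ ℓ₂ q}
                      (E₁ : Extension F n) {φ₁} (φ₁-iso : IsLinearIsomorphism F n E₁ φ₁)
                      (E₂ : Extension F n) {φ₂} (φ₂-iso : IsLinearIsomorphism F n E₂ φ₂) where

  open TwoSpreads E₁ φ₁-iso E₂ φ₂-iso
  open S₁ using () renaming (_•_ to infixr 7 _•₁_)
  open S₂ using () renaming (_•_ to infixr 7 _•₂_)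
  private
    module F = FiniteField F
    module V₁ = S₁.VK
    module V₂ = S₂.VK
    embed₁ = Extension.embed E₁
    embed₂ = Extension.embed E₂
    V-size = coordinateSpaceSize F.ring (2 *ℕ n) F.hasSize

  open LeftModule (V F n) using
    (_≈ᴹ_; 0ᴹ; ≈ᴹ-sym; ≈ᴹ-trans; ≈ᴹ-setoid; +ᴹ-cong; -ᴹ‿cong)
  open ≈-Reasoning ≈ᴹ-setoid

  -- The subfield `N`, realised inside `K₁`.
  Commuting : Pred K₁.Carrier (c ⊔ ℓ₁)
  Commuting k = ∃[ k′ ] k ~ k′

  Commuting-resp : ∀ {k l} → k K₁.≈ l → Commuting k → Commuting l
  Commuting-resp k≈l (k′ , k~k′) = k′ , λ v → ≈ᴹ-trans (V₁.*ₗ-congʳ (K₁.sym k≈l)) (k~k′ v)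

  -- Both quantifiers, over `K₂` and over `V`, range over finite sets. Decidability is what allows
  -- `N` to be counted.
  Commuting? : U.Decidable Commuting
  Commuting? k = search
    (λ k′≈l′ k~k′ v → ≈ᴹ-trans (k~k′ v) (V₂.*ₗ-congʳ k′≈l′)) ~?
    where
    open Finite K₂.setoid K₂.hasSize
    module FV = Finite ≈ᴹ-setoid V-size
    ~? : ∀ k′ → Dec (k ~ k′)
    ~? k′ with FV.search-counterexample
        (λ u≈v ku≈ → ≈ᴹ-trans (V₁.*ₗ-congˡ (≈ᴹ-sym u≈v)) (≈ᴹ-trans ku≈ (V₂.*ₗ-congˡ u≈v)))
        (λ v → k •₁ v FV.≟ k′ •₂ v)
    ... | inj₁ (v , kv≉) = no λ k~k′ → kv≉ (k~k′ v)
    ... | inj₂ k~k′      = yes k~k′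

  Commuting-subring : IsSubring K₁.ring Commuting
  Commuting-subring = record
    { +-closed = λ { {k} {l} (k′ , k~k′) (l′ , l~l′) → k′ K₂.+ l′ , λ v →
        ≈ᴹ-trans (V₁.*ₗ-distribʳ v k l) (≈ᴹ-trans (+ᴹ-cong (k~k′ v) (l~l′ v))
          (≈ᴹ-sym (V₂.*ₗ-distribʳ v k′ l′))) }
    ; *-closed = λ { {k} {l} (k′ , k~k′) (l′ , l~l′) → k′ K₂.* l′ , λ v →
        ≈ᴹ-trans (V₁.*ₗ-assoc k l v) (≈ᴹ-trans (k~k′ (l •₁ v)) (≈ᴹ-trans
          (V₂.*ₗ-congˡ (l~l′ v)) (≈ᴹ-sym (V₂.*ₗ-assoc k′ l′ v)))) }
    ; -‿closed = λ { {k} (k′ , k~k′) → K₂.- k′ , λ v →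
        ≈ᴹ-trans (-‿distribˡ-*ₗ S₁.VK k v) (≈ᴹ-trans (-ᴹ‿cong (k~k′ v))
          (≈ᴹ-sym (-‿distribˡ-*ₗ S₂.VK k′ v))) }
    ; 0-closed = K₂.0# , λ v → ≈ᴹ-trans (V₁.*ₗ-zeroˡ v) (≈ᴹ-sym (V₂.*ₗ-zeroˡ v))
    ; 1-closed = K₂.1# , λ v → ≈ᴹ-trans (V₁.*ₗ-identityˡ v) (≈ᴹ-sym (V₂.*ₗ-identityˡ v))
    }

  embed-commuting : ∀ r → Commuting (embed₁ r)
  embed-commuting r = embed₂ r , λ v → ≈ᴹ-trans (S₁.embed-• r v) (≈ᴹ-sym (S₂.embed-• r v))

  open Subring Commuting-subring using (subring; inclusion-isRingHomomorphism)

  size : ℕ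
  size = proj₁ (subsetoidSize K₁.setoid K₁.hasSize Commuting-resp Commuting?)

  hasSize : HasSize (subsetoid K₁.setoid Commuting) size
  hasSize = proj₂ (subsetoidSize K₁.setoid K₁.hasSize Commuting-resp Commuting?)

  -- On the zero space k ~ k′ would hold for all k and k′, so k ≉ 0# would not
  -- make k′ invertible.
  module _ {a} (a≉0 : ¬ a ≈ᴹ 0ᴹ) where

    -- Since `k′ l v = k l v = v` for all `v`, the inverse of `k′` acts as `l`. It exists because
    -- `k′` moves `a` to the nonzero vector `k a`.
    Commuting-inverse : ∀ {k l} → Commuting k → ¬ k K₁.≈ K₁.0# → l K₁.* k K₁.≈ K₁.1# → Commuting l
    Commuting-inverse {k} {l} (k′ , k~k′) k≉0 lk≈1 =
      _ , λ v → S₂.invert k′≉0 (begin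
        k′ •₂ l •₁ v        ≈⟨ k~k′ (l •₁ v) ⟨
        k •₁ l •₁ v         ≈⟨ V₁.*ₗ-assoc k l v ⟨
        (k K₁.* l) •₁ v     ≈⟨ V₁.*ₗ-congʳ (K₁.trans (K₁.*-comm k l) lk≈1) ⟩
        K₁.1# •₁ v          ≈⟨ V₁.*ₗ-identityˡ v ⟩
        v                   ∎)
      where
      k′≉0 : ¬ k′ K₂.≈ K₂.0#
      k′≉0 k′≈0 = S₁.*ₗ-≉0 k≉0 a≉0 (≈ᴹ-trans (k~k′ a)
        (≈ᴹ-trans (V₂.*ₗ-congʳ k′≈0) (V₂.*ₗ-zeroˡ a)))

    subring-division : FiniteDivisionRing subring size
    subring-division = record
      { size    = hasSize
      ; 1≉0     = FiniteDivisionRing.1≉0 S₁.K-division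
      ; inverse = λ { {k , k∈} k≉0 →
          let l , lk≈1 = FiniteDivisionRing.inverse S₁.K-division k≉0
          in (l , Commuting-inverse k∈ k≉0 lk≈1) , lk≈1 }
      }

    Commuting-submodule : IsSubmodule S₁.K-over-F Commuting
    Commuting-submodule = record
      { resp      = Commuting-resp
      ; 0ᴹ-closed = 0-closed
      ; +ᴹ-closed = +-closed
      ; *ₗ-closed = λ r → *-closed (embed-commuting r)
      }
      where open IsSubring Commuting-subring

    private
      N-over-F : LeftModule F.ring _ _
      N-over-F = submodule S₁.K-over-F Commuting-submodule

      K-over-N : LeftModule subring _ _
      K-over-N = restrictScalars proj₁ inclusion-isRingHomomorphism (TensorUnit.leftModule {R = K₁.ring})

      module NF = VectorSpace S₁.F-division N-over-F
      module KN = VectorSpace subring-division K-over-N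

      1≉0 : ¬ K₁.1# K₁.≈ K₁.0#
      1≉0 = FiniteDivisionRing.1≉0 S₁.K-division

      N-size : HasSize (LeftModule.≈ᴹ-setoid N-over-F) size
      N-size = record { Inverse hasSize }

      K-size : HasSize (LeftModule.≈ᴹ-setoid K-over-N) (q ^ n)
      K-size = record { Inverse K₁.hasSize }

      -- If `t` is 1, the unit spans `N` over `F`, so `N` is the image of `F`. The implication is
      -- returned together with `t` because it needs the spanning family behind `t`.
      dimension-over-F : ∃[ t ] size ≡ q ^ t ×
        (t ≡ 1 → ∀ {k} → Commuting k → ∃[ r ] k K₁.≈ embed₁ r)
      dimension-over-F =
        let t , e , indep , spans = NF.∃basis N-size
        in t , NF.basis-size N-size indep spans , λ t≡1 → prime-subfield t≡1 spans
        where
        -- With `t` a variable, matching on `t ≡ 1` can fix the length of the family `e`.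
        prime-subfield : ∀ {t} → t ≡ 1 → {e : Vector _ t} → (∀ v → Span N-over-F e v) →
                         ∀ {k} → Commuting k → ∃[ r ] k K₁.≈ embed₁ r
        prime-subfield ≡.refl {e} spans {k} k∈ =
          let r , k≈ = NF.one-dimensional {u = K₁.1# , IsSubring.1-closed Commuting-subring}
                         {v = k , k∈} {e = e} spans 1≉0
          in r , K₁.trans k≈ (K₁.*-identityʳ (embed₁ r))

      dimension-of-K : ∃[ m ] q ^ n ≡ size ^ m × (m ≡ 1 → ∀ k → Commuting k)
      dimension-of-K =
        let m , e , indep , spans = KN.∃basis K-size
        in m , KN.basis-size K-size indep spans , λ m≡1 → everything m≡1 spans
        where
        everything : ∀ {m} → m ≡ 1 → {e : Vector _ m} → (∀ v → Span K-over-N e v) →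
                     ∀ k → Commuting k
        everything ≡.refl {e} spans k =
          let (l , l∈) , k≈ = KN.one-dimensional {u = K₁.1#} {v = k} {e = e} spans 1≉0
          in Commuting-resp (K₁.sym (K₁.trans k≈ (K₁.*-identityʳ l))) l∈

    -- The two counts combine to `q ^ n ≡ (q ^ t) ^ m`, and exponents of `q` can be compared because
    -- `1 < q`.
    dimensions : ∃[ t ] ∃[ m ] size ≡ q ^ t × n ≡ t *ℕ m ×
      (t ≡ 1 → ∀ {k} → Commuting k → ∃[ r ] k K₁.≈ embed₁ r) ×
      (m ≡ 1 → ∀ k → Commuting k)
    dimensions =
      let t , size≡ , t≡1⇒ = dimension-over-F
          m , qⁿ≡ , m≡1⇒   = dimension-of-K
      in t , m , size≡
       , ^-injectiveʳ (FiniteDivisionRing.1<q S₁.F-division) (≡.trans qⁿ≡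
           (≡.trans (≡.cong (_^ m) size≡) (ℕ.^-*-assoc q t m)))
       , t≡1⇒ , m≡1⇒

-- The common elements of the two spreads

module Intersection {q n} {F : FiniteField c ℓ₁ ℓ₂ q}
  (E₁ : Extension F n) {φ₁} (φ₁-iso : IsLinearIsomorphism F n E₁ φ₁)
  (E₂ : Extension F n) {φ₂} (φ₂-iso : IsLinearIsomorphism F n E₂ φ₂)
  {D₁ : Pred (Space F n) ℓ₃} {D₂ : Pred (Space F n) ℓ₄}
  (D₁-spread : ∀ S → S ∈ D₁ ⇔ (∃[ P ] Subspace.member S ≐ Image F n E₁ φ₁ P))
  (D₂-spread : ∀ S → S ∈ D₂ ⇔ (∃[ P ] Subspace.member S ≐ Image F n E₂ φ₂ P)) where

  open TwoSpreads E₁ φ₁-iso E₂ φ₂-iso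
  private
    module Swapped = TwoSpreads E₂ φ₂-iso E₁ φ₁-iso
    module V₁ = S₁.VK
    module V₂ = S₂.VK
    module Vₛ = LeftModule (V F n)
  open S₁ using () renaming (_•_ to infixr 7 _•₁_)
  open S₂ using () renaming (_•_ to infixr 7 _•₂_)
  open CommonSubfield E₁ φ₁-iso E₂ φ₂-iso
  open LeftModule (V F n) using
    ( Carrierᴹ; _≈ᴹ_; _+ᴹ_; 0ᴹ; ≈ᴹ-refl; ≈ᴹ-sym; ≈ᴹ-trans; ≈ᴹ-setoid
    ; +ᴹ-cong; +ᴹ-congˡ; +ᴹ-congʳ)
  open Setoid (spaces F n) using () renaming (_≈_ to _≋_)
  open Subspace using (member)

  D₁∩D₂ : Pred (Space F n) _
  D₁∩D₂ = D₁ ∩ D₂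

  line₁-through : ∀ {S v} → S ∈ D₁ → ¬ v ≈ᴹ 0ᴹ → v ∈ member S → member S ≐ S₁.Line v
  line₁-through S∈D₁ =
    let _ , _ , S≐ = S₁.∈spread⇒line D₁-spread S∈D₁ in S₁.line-through S≐

  line₂-through : ∀ {S v} → S ∈ D₂ → ¬ v ≈ᴹ 0ᴹ → v ∈ member S → member S ≐ S₂.Line v
  line₂-through S∈D₂ =
    let _ , _ , S≐ = S₂.∈spread⇒line D₂-spread S∈D₂ in S₂.line-through S≐

  lines-agree : ∀ {S v} → S ∈ D₁∩D₂ → ¬ v ≈ᴹ 0ᴹ → v ∈ member S → S₁.Line v ≐ S₂.Line v
  lines-agree {S} (S∈D₁ , S∈D₂) v≉0 v∈S =
    ≐-trans (≐-sym (line₁-through {S} S∈D₁ v≉0 v∈S)) (line₂-through {S} S∈D₂ v≉0 v∈S)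

  nonzero-vector : ∀ {S} → S ∈ D₁ → ∃[ v ] ¬ v ≈ᴹ 0ᴹ × v ∈ member S
  nonzero-vector S∈D₁ =
    let u , u≉0 , S≐ = S₁.∈spread⇒line D₁-spread S∈D₁ in u , u≉0 , proj₂ S≐ S₁.Line-refl

  -- Both are the `K₁`-line of `v`. Read contrapositively, this is the disjointness of distinct
  -- spread elements.
  meets⇒≋ : ∀ {S T v} → S ∈ D₁ → T ∈ D₁ → ¬ v ≈ᴹ 0ᴹ → v ∈ member S → v ∈ member T → S ≋ T
  meets⇒≋ {S} {T} S∈D₁ T∈D₁ v≉0 v∈S v∈T =
    ≐-trans (line₁-through {S} S∈D₁ v≉0 v∈S) (≐-sym (line₁-through {T} T∈D₁ v≉0 v∈T))

  lineSpace∈ : ∀ {u} (u≉0 : ¬ u ≈ᴹ 0ᴹ) → S₁.Line u ≐ S₂.Line u → S₁.lineSpace u u≉0 ∈ D₁∩D₂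
  lineSpace∈ u≉0 u≐ = S₁.line⇒∈spread D₁-spread u≉0 (id , id)
                    , S₂.line⇒∈spread D₂-spread u≉0 u≐

  frame-in : ∀ {A B C a b} → A ∈ D₁∩D₂ → B ∈ D₁∩D₂ → C ∈ D₁∩D₂ → ¬ A ≋ B →
             ¬ a ≈ᴹ 0ᴹ → ¬ b ≈ᴹ 0ᴹ → ¬ a +ᴹ b ≈ᴹ 0ᴹ →
             a ∈ member A → b ∈ member B → a +ᴹ b ∈ member C → Frame a b
  frame-in {A} {B} {C} A∈D B∈D C∈D A≉B a≉0 b≉0 a+b≉0 a∈A b∈B a+b∈C = record
    { a≉0  = a≉0
    ; b≉0  = b≉0
    ; b∉a  = λ b∈a → A≉B (meets⇒≋ {A} {B} (proj₁ A∈D) (proj₁ B∈D) b≉0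
               (proj₂ (line₁-through {A} (proj₁ A∈D) a≉0 a∈A) b∈a) b∈B)
    ; a≐   = lines-agree {A} A∈D a≉0 a∈A
    ; b≐   = lines-agree {B} B∈D b≉0 b∈B
    ; a+b≐ = lines-agree {C} C∈D a+b≉0 a+b∈C
    }

  module _ {a b} (frame : Frame a b) where
    open Frame frame
    open ≈-Reasoning ≈ᴹ-setoid

    private
      -- Frames are symmetric in the spreads, so results that move scalars or inclusions from `K₁`
      -- to `K₂` also yield the opposite direction.
      frame-swapped : Swapped.Frame a b
      frame-swapped = record
        { a≉0 = a≉0 ; b≉0 = b≉0 ; b∉a = b∉₂a
        ; a≐ = ≐-sym a≐ ; b≐ = ≐-sym b≐ ; a+b≐ = ≐-sym a+b≐ }

    point : K₁.Carrier → Carrierᴹ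
    point k = a +ᴹ k •₁ b

    private
      point≈ : ∀ k → point k ≈ᴹ K₁.1# •₁ a +ᴹ k •₁ b
      point≈ k = +ᴹ-congʳ (≈ᴹ-sym (V₁.*ₗ-identityˡ a))

      point∉b : ∀ {k r} → ¬ point k ≈ᴹ r •₁ b
      point∉b {k} {r} pk≈ = FiniteDivisionRing.1≉0 S₁.K-division
        (proj₁ (S₁.Plane-unique a≉0 b≉0 b∉a (begin
          K₁.1# •₁ a +ᴹ k •₁ b    ≈⟨ point≈ k ⟨
          point k                 ≈⟨ pk≈ ⟩
          r •₁ b                  ≈⟨ Vₛ.+ᴹ-identityˡ _ ⟨
          0ᴹ +ᴹ r •₁ b            ≈⟨ +ᴹ-congʳ (V₁.*ₗ-zeroˡ a) ⟨
          K₁.0# •₁ a +ᴹ r •₁ b    ∎)))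

    point≉0 : ∀ k → ¬ point k ≈ᴹ 0ᴹ
    point≉0 k pk≈0 = point∉b (≈ᴹ-trans pk≈0 (≈ᴹ-sym (V₁.*ₗ-zeroˡ b)))

    -- The coefficient 1 of `a` in both points forces the scalar between them to be 1.
    point-injective : ∀ {k l} → S₁.Line (point l) (point k) → k K₁.≈ l
    point-injective {k} {l} (r , pk≈) =
      let 1≈r , k≈rl = S₁.Plane-unique a≉0 b≉0 b∉a (begin
            K₁.1# •₁ a +ᴹ k •₁ b           ≈⟨ point≈ k ⟨
            point k                        ≈⟨ pk≈ ⟩
            r •₁ (a +ᴹ l •₁ b)             ≈⟨ V₁.*ₗ-distribˡ r a _ ⟩
            r •₁ a +ᴹ r •₁ l •₁ b          ≈⟨ +ᴹ-congˡ (V₁.*ₗ-assoc r l b) ⟨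
            r •₁ a +ᴹ (r K₁.* l) •₁ b      ∎)
      in K₁.trans k≈rl (K₁.trans (K₁.*-congʳ (K₁.sym 1≈r)) (K₁.*-identityˡ l))

    -- The second inclusion is the first one for the exchanged spreads: since `k ~ k′`, the point is
    -- also `a + k′ b` over `K₂`.
    point-agrees : ∀ {k} → Commuting k → S₁.Line (point k) ≐ S₂.Line (point k)
    point-agrees {k} (k′ , k~k′) =
        commutes⇒slope frame k~k′
      , λ v∈ → S₁.Line-cong (≈ᴹ-sym pk≈) (Swapped.commutes⇒slope frame-swapped
          (λ v → ≈ᴹ-sym (k~k′ v)) (S₂.Line-cong pk≈ v∈))
      where
      pk≈ : point k ≈ᴹ a +ᴹ k′ •₂ b
      pk≈ = +ᴹ-congˡ (k~k′ b)

    -- Take a nonzero `x a + y b` in `S`. If `x` is zero, it spans the line of `b`; otherwise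
    -- division by `x` turns it into a point, whose slope is in `N` by `slope-commutes`.
    classify : ∀ {S} → S ∈ D₁∩D₂ →
               b ∈ member S ⊎ (∃[ k ] Commuting k × point k ∈ member S)
    classify {S} S∈D = go (S₁.decompose a≉0 b∉a w) (x≟0 _)
      where
      x≟0 : ∀ x → Dec (x K₁.≈ K₁.0#)
      x≟0 x = FiniteDivisionRing._≟_ S₁.K-division x K₁.0#
      w = proj₁ (nonzero-vector {S} (proj₁ S∈D))
      w≉0 : ¬ w ≈ᴹ 0ᴹ
      w≉0 = proj₁ (proj₂ (nonzero-vector {S} (proj₁ S∈D)))
      w∈S : w ∈ member S
      w∈S = proj₂ (proj₂ (nonzero-vector {S} (proj₁ S∈D)))
      S≐w : member S ≐ S₁.Line w
      S≐w = line₁-through {S} (proj₁ S∈D) w≉0 w∈S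
      go : (w∈ab : S₁.Plane a b w) → Dec (proj₁ w∈ab K₁.≈ K₁.0#) →
           b ∈ member S ⊎ (∃[ k ] Commuting k × point k ∈ member S)
      go (x , y , w≈) (yes x≈0) = inj₁ (proj₂ S≐w (S₁.Line-sym w≉0 (y , (begin
        w                        ≈⟨ w≈ ⟩
        x •₁ a +ᴹ y •₁ b         ≈⟨ +ᴹ-congʳ (V₁.*ₗ-congʳ x≈0) ⟩
        K₁.0# •₁ a +ᴹ y •₁ b     ≈⟨ +ᴹ-congʳ (V₁.*ₗ-zeroˡ a) ⟩
        0ᴹ +ᴹ y •₁ b             ≈⟨ Vₛ.+ᴹ-identityˡ _ ⟩
        y •₁ b                   ∎))))
      go (x , y , w≈) (no x≉0) = inj₂ (k , slope-commutes frame pk⊆ , pk∈S)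
        where
        s = proj₁ (FiniteDivisionRing.inverse S₁.K-division x≉0)
        k = s K₁.* y
        pk∈S : point k ∈ member S
        pk∈S = proj₂ S≐w (s , (begin
          a +ᴹ k •₁ b                         ≈⟨ point≈ k ⟩
          K₁.1# •₁ a +ᴹ (s K₁.* y) •₁ b
            ≈⟨ +ᴹ-cong (V₁.*ₗ-congʳ (proj₂ (FiniteDivisionRing.inverse S₁.K-division x≉0)))
                       (≈ᴹ-sym (V₁.*ₗ-assoc s y b)) ⟨
          (s K₁.* x) •₁ a +ᴹ s •₁ y •₁ b      ≈⟨ +ᴹ-congʳ (V₁.*ₗ-assoc s x a) ⟩
          s •₁ x •₁ a +ᴹ s •₁ y •₁ b          ≈⟨ V₁.*ₗ-distribˡ s _ _ ⟨
          s •₁ (x •₁ a +ᴹ y •₁ b)             ≈⟨ V₁.*ₗ-congˡ w≈ ⟨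
          s •₁ w                              ∎))
        pk⊆ : S₁.Line (point k) ⊆ S₂.Line (point k)
        pk⊆ = proj₁ (lines-agree {S} S∈D (point≉0 k) pk∈S)

    private
      -- The projective line over `N`. The extra element is the line of `b`, and it accounts for the
      -- summand 1 in the size.
      SlopeOr∞ : Setoid _ _
      SlopeOr∞ = subsetoid K₁.setoid Commuting ⊎ₛ ≡.setoid (Fin 1)

      module Slopes = Setoid SlopeOr∞

      Common : Setoid _ _
      Common = subsetoid (spaces F n) D₁∩D₂

      space : Slopes.Carrier → Setoid.Carrier Common
      space (inj₁ (k , k∈)) = S₁.lineSpace (point k) (point≉0 k)
                            , lineSpace∈ (point≉0 k) (point-agrees k∈)
      space (inj₂ _)        = S₁.lineSpace b b≉0 , lineSpace∈ b≉0 b≐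

      space-cong : ∀ {x y} → x Slopes.≈ y → Setoid._≈_ Common (space x) (space y)
      space-cong (inj₁ k≈l) = S₁.Line-cong pk≈pl , S₁.Line-cong (≈ᴹ-sym pk≈pl)
        where pk≈pl = +ᴹ-congˡ (V₁.*ₗ-congʳ k≈l)
      space-cong (inj₂ _)   = id , id

      space-injective : ∀ {x y} → Setoid._≈_ Common (space x) (space y) → x Slopes.≈ y
      space-injective {inj₁ _} {inj₁ _} (k⊆l , _) = inj₁ (point-injective (k⊆l S₁.Line-refl))
      space-injective {inj₁ _} {inj₂ _} (k⊆∞ , _) = contradiction (proj₂ (k⊆∞ S₁.Line-refl)) point∉b
      space-injective {inj₂ _} {inj₁ _} (_ , k⊆∞) = contradiction (proj₂ (k⊆∞ S₁.Line-refl)) point∉b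
      space-injective {inj₂ zero} {inj₂ zero} _ = inj₂ ≡.refl

      space-surjective : ∀ S → ∃[ x ] Setoid._≈_ Common (space x) S
      space-surjective (S , S∈D) = go (classify {S} S∈D)
        where
        go : _ → ∃[ x ] Setoid._≈_ Common (space x) (S , S∈D)
        go (inj₁ b∈S) = inj₂ zero , ≐-sym (line₁-through {S} (proj₁ S∈D) b≉0 b∈S)
        go (inj₂ (k , k∈ , pk∈S)) =
          inj₁ (k , k∈) , ≐-sym (line₁-through {S} (proj₁ S∈D) (point≉0 k) pk∈S)

    intersection-size : HasSize (subsetoid (spaces F n) D₁∩D₂) (size +ℕ 1)
    intersection-size = Comp.inverse (Inv.sym (Bijection⇒Inverse bijection))
      (Comp.inverse (hasSize ⊎-inverse Inv.refl (≡.setoid (Fin 1)))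
      (Comp.inverse (Pointwise-≡↔≡ _ _) (Inv.sym +↔⊎)))
      where
      bijection : Bijection SlopeOr∞ Common
      bijection = record
        { to        = space
        ; cong      = λ {x} {y} → space-cong {x} {y}
        ; bijective = (λ {x} {y} → space-injective {x} {y}) , λ S →
            let x , x≈S = space-surjective S
            in x , λ {z} z≈x → ≐-trans (space-cong {z} {x} z≈x) x≈S
        }

    -- The hypothesis speaks of `K₁` only, so a scalar `k′` of `K₂` is first transferred to some
    -- `k`. The partner `l′` of `k` agrees with `k′` at `a` and hence equals it.
    commuting⇒agree : (∀ k → Commuting k) → ∀ w → S₁.Line w ≐ S₂.Line w
    commuting⇒agree commuting w = to , from
      where
      to : S₁.Line w ⊆ S₂.Line w
      to (k , v≈) = let k′ , k~k′ = commuting k in k′ , ≈ᴹ-trans v≈ (k~k′ w)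
      from : S₂.Line w ⊆ S₁.Line w
      from {v} (k′ , v≈) =
        let k , k′a≈ , _ = Swapped.transfer frame-swapped k′
            l′ , k~l′    = commuting k
            k′≈l′        = S₂.*ₗ-cancelʳ a≉0 (≈ᴹ-trans k′a≈ (k~l′ a))
        in k , ≈ᴹ-trans v≈ (≈ᴹ-trans (V₂.*ₗ-congʳ k′≈l′) (≈ᴹ-sym (k~l′ w)))

    commuting⇒coincide : (∀ k → Commuting k) → D₁ ≐ D₂
    commuting⇒coincide commuting =
        (λ {S} S∈D₁ → let u , u≉0 , S≐ = S₁.∈spread⇒line D₁-spread S∈D₁
                      in S₂.line⇒∈spread D₂-spread u≉0 (≐-trans S≐ (agree u)))
      , (λ {S} S∈D₂ → let u , u≉0 , S≐ = S₂.∈spread⇒line D₂-spread S∈D₂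
                      in S₁.line⇒∈spread D₁-spread u≉0 (≐-trans S≐ (≐-sym (agree u))))
      where agree = commuting⇒agree commuting

  -- Neither summand vanishes: if `a` did, the nonzero vector `c` would lie in both `B` and `C`, and
  -- likewise for `b` with `A` and `C`.
  frame-of-sum : ∀ {A B C a b c} → A ∈ D₁∩D₂ → B ∈ D₁∩D₂ → C ∈ D₁∩D₂ →
                 ¬ A ≋ B → ¬ A ≋ C → ¬ B ≋ C →
                 a ∈ member A → b ∈ member B → c ∈ member C →
                 ¬ c ≈ᴹ 0ᴹ → c ≈ᴹ a +ᴹ b → Frame a b
  frame-of-sum {A} {B} {C} {a} {b} {c} A∈D B∈D C∈D A≉B A≉C B≉C a∈A b∈B c∈C c≉0 c≈a+b =
    frame-in {A} {B} {C} A∈D B∈D C∈D A≉B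
      (λ a≈0 → B≉C (meets⇒≋ {B} {C} (proj₁ B∈D) (proj₁ C∈D) c≉0
        (resp B (≈ᴹ-sym (≈ᴹ-trans c≈a+b (≈ᴹ-trans (+ᴹ-congʳ a≈0) (Vₛ.+ᴹ-identityˡ b)))) b∈B) c∈C))
      (λ b≈0 → A≉C (meets⇒≋ {A} {C} (proj₁ A∈D) (proj₁ C∈D) c≉0
        (resp A (≈ᴹ-sym (≈ᴹ-trans c≈a+b (≈ᴹ-trans (+ᴹ-congˡ b≈0) (Vₛ.+ᴹ-identityʳ a)))) a∈A) c∈C))
      (λ a+b≈0 → c≉0 (≈ᴹ-trans c≈a+b a+b≈0))
      a∈A b∈B (resp C c≈a+b c∈C)
    where
    resp : ∀ S {u v} → u ≈ᴹ v → u ∈ member S → v ∈ member S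
    resp S = IsSubmodule.resp (Subspace.isSubmodule S)

  -- `R` varies so that the three elements can also be taken among the common elements that meet a
  -- given line.
  module Three {R : Pred (Space F n) p} (R⊆ : R ⊆ D₁∩D₂)
               (three : AtLeast 3 (subsetoid (spaces F n) R)) where

    open Injection three using (to; injective)

    A B C : Space F n
    A = proj₁ (to zero)
    B = proj₁ (to (suc zero))
    C = proj₁ (to (suc (suc zero)))

    A∈ : A ∈ D₁∩D₂
    A∈ = R⊆ {A} (proj₂ (to zero))
    B∈ : B ∈ D₁∩D₂
    B∈ = R⊆ {B} (proj₂ (to (suc zero)))
    C∈ : C ∈ D₁∩D₂
    C∈ = R⊆ {C} (proj₂ (to (suc (suc zero))))

    A≉B : ¬ A ≋ B
    A≉B A≋B with () ← injective A≋B
    A≉C : ¬ A ≋ C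
    A≉C A≋C with () ← injective A≋C
    B≉C : ¬ B ≋ C
    B≉C B≋C with () ← injective B≋C

    frame-from : ∀ {a b c} → a ∈ member A → b ∈ member B → c ∈ member C →
                 ¬ c ≈ᴹ 0ᴹ → c ≈ᴹ a +ᴹ b → Frame a b
    frame-from = frame-of-sum {A} {B} {C} A∈ B∈ C∈ A≉B A≉C B≉C

    -- Vectors of `A` and `B` must be rescaled for their sum to lie in `C`. The scalars are the
    -- coordinates of a vector of `C`.
    frame-exists : ∃[ a ] ∃[ b ] Frame a b
    frame-exists =
      let a , a≉0 , a∈A = nonzero-vector {A} (proj₁ A∈)
          b , b≉0 , b∈B = nonzero-vector {B} (proj₁ B∈)
          c , c≉0 , c∈C = nonzero-vector {C} (proj₁ C∈)
          A≐a = line₁-through {A} (proj₁ A∈) a≉0 a∈A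
          B≐b = line₁-through {B} (proj₁ B∈) b≉0 b∈B
          b∉a = λ b∈a → A≉B (meets⇒≋ {A} {B} (proj₁ A∈) (proj₁ B∈) b≉0 (proj₂ A≐a b∈a) b∈B)
          x , y , c≈ = S₁.decompose a≉0 b∉a c
      in x •₁ a , y •₁ b ,
         frame-from (proj₂ A≐a (x , ≈ᴹ-refl)) (proj₂ B≐b (y , ≈ᴹ-refl)) c∈C c≉0 c≈

  module _ (prime-subfield : ∀ {k} → Commuting k → ∃[ r ] k K₁.≈ Extension.embed E₁ r) where

    -- The frame can be chosen inside `L`. As all common slopes come from `F`, the vectors `b` and
    -- `a + r b` that span the common elements then stay in the `F`-subspace `L`.
    transversal : (L : Subspace (V F n) 2) →
                  AtLeast 3 (subsetoid (spaces F n) (D₁∩D₂ ∩ Meets (V F n) L)) →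
                  D₁∩D₂ ⊆ Meets (V F n) L
    transversal L three {S} S∈D = meet (classify frame {S} S∈D)
      where
      open Three {R = D₁∩D₂ ∩ Meets (V F n) L} proj₁ three
      open Injection three using (to)
      open IsSubmodule
      module VL = VectorSpace (finiteField⇒divisionRing F) (V F n)
      module L = Subspace L

      a-meet = proj₂ (proj₂ (to zero))
      b-meet = proj₂ (proj₂ (to (suc zero)))
      c-meet = proj₂ (proj₂ (to (suc (suc zero))))
      a₀ b₀ c₀ : Carrierᴹ
      a₀ = proj₁ a-meet
      b₀ = proj₁ b-meet
      c₀ = proj₁ c-meet
      a₀≉0 : ¬ a₀ ≈ᴹ 0ᴹ
      a₀≉0 = proj₁ (proj₂ a-meet)
      b₀≉0 : ¬ b₀ ≈ᴹ 0ᴹ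
      b₀≉0 = proj₁ (proj₂ b-meet)
      c₀≉0 : ¬ c₀ ≈ᴹ 0ᴹ
      c₀≉0 = proj₁ (proj₂ c-meet)
      a₀∈L : a₀ ∈ L.member
      a₀∈L = proj₁ (proj₂ (proj₂ a-meet))
      b₀∈L : b₀ ∈ L.member
      b₀∈L = proj₁ (proj₂ (proj₂ b-meet))
      c₀∈L : c₀ ∈ L.member
      c₀∈L = proj₁ (proj₂ (proj₂ c-meet))
      a₀∈A : a₀ ∈ member A
      a₀∈A = proj₂ (proj₂ (proj₂ a-meet))
      b₀∈B : b₀ ∈ member B
      b₀∈B = proj₂ (proj₂ (proj₂ b-meet))
      c₀∈C : c₀ ∈ member C
      c₀∈C = proj₂ (proj₂ (proj₂ c-meet))

      in-plane : ∀ {v} → v ∈ L.member → VL.Plane (L.basis zero) (L.basis (suc zero)) v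
      in-plane v∈L =
        let x , v≈ = L.spanning v∈L
        in x zero , x (suc zero) , ≈ᴹ-trans v≈ (+ᴹ-congˡ (Vₛ.+ᴹ-identityʳ _))

      b₀∉a₀ : ¬ VL.Line a₀ b₀
      b₀∉a₀ (r , b₀≈) = A≉B (meets⇒≋ {A} {B} (proj₁ A∈) (proj₁ B∈) b₀≉0
        (resp (Subspace.isSubmodule A) (≈ᴹ-sym b₀≈) (*ₗ-closed (Subspace.isSubmodule A) r a₀∈A)) b₀∈B)

      -- The coordinates of `c₀` are taken over `F` within the two-dimensional `L`: the rescaled `a`
      -- and `b` must not leave `L`, which is not closed under `K₁` in general.
      c₀∈a₀b₀ : VL.Plane a₀ b₀ c₀
      c₀∈a₀b₀ = VL.Plane-exchange a₀≉0 b₀∉a₀ (in-plane a₀∈L) (in-plane b₀∈L) (in-plane c₀∈L)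

      x = proj₁ c₀∈a₀b₀
      y = proj₁ (proj₂ c₀∈a₀b₀)
      a b : Carrierᴹ
      a = x Vₛ.*ₗ a₀
      b = y Vₛ.*ₗ b₀

      frame : Frame a b
      frame = frame-from (*ₗ-closed (Subspace.isSubmodule A) x a₀∈A)
        (*ₗ-closed (Subspace.isSubmodule B) y b₀∈B) c₀∈C c₀≉0 (proj₂ (proj₂ c₀∈a₀b₀))

      b∈L : b ∈ L.member
      b∈L = *ₗ-closed L.isSubmodule y b₀∈L

      point∈L : ∀ {k} → Commuting k → point frame k ∈ L.member
      point∈L {k} k∈ =
        let r , k≈r = prime-subfield k∈
        in resp L.isSubmodule
             (+ᴹ-congˡ (≈ᴹ-sym (≈ᴹ-trans (V₁.*ₗ-congʳ k≈r) (S₁.embed-• r b))))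
             (+ᴹ-closed L.isSubmodule (*ₗ-closed L.isSubmodule x a₀∈L)
               (*ₗ-closed L.isSubmodule r b∈L))

      meet : b ∈ member S ⊎ (∃[ k ] Commuting k × point frame k ∈ member S) →
             Meets (V F n) L S
      meet (inj₁ b∈S)             = b , Frame.b≉0 frame , b∈L , b∈S
      meet (inj₂ (k , k∈ , pk∈S)) = point frame k , point≉0 frame k , point∈L k∈ , pk∈S

    regulus : ∀ {a b} → Frame a b → size ≡ q → IsRegulus F n D₁∩D₂
    regulus frame size≡q = record
      { size     = ≡.subst (λ s → HasSize (subsetoid (spaces F n) D₁∩D₂) (s +ℕ 1)) size≡q
                     (intersection-size frame)
      ; disjoint = λ {S} {T} S∈D T∈D S≉T (v , v≉0 , v∈S , v∈T) →
          S≉T (meets⇒≋ {S} {T} (proj₁ S∈D) (proj₁ T∈D) v≉0 v∈S v∈T)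
      ; lines    = λ L three {S} → transversal L three {S}
      }

open import Data.Nat.Base using (_+_)

corollary1p6 : {c ℓ₁ ℓ₂ ℓ₃ ℓ₄ : Level} (p h q n : ℕ) .{{_ : NonZero n}} →
    Prime p → q ≡ p ^ h → 2 < q →
    (F : FiniteField c ℓ₁ ℓ₂ q) →
    (D₁ : Pred (Space F n) ℓ₃) (D₂ : Pred (Space F n) ℓ₄) →
    IsDesarguesianSpread F n D₁ → IsDesarguesianSpread F n D₂ →
    AtLeast 3 (subsetoid (spaces F n) (D₁ ∩ D₂)) →
    (∃[ t ] t ∣ n × HasSize (subsetoid (spaces F n) (D₁ ∩ D₂)) (q ^ t + 1)) ×
    (Prime n → IsRegulus F n (D₁ ∩ D₂) ⊎ D₁ ≐ D₂)
corollary1p6 p h q n _ _ _ F D₁ D₂ (E₁ , φ₁ , φ₁-iso , D₁-spread) (E₂ , φ₂ , φ₂-iso , D₂-spread) three =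
    (t , t∣n , ≡.subst (λ s → HasSize (subsetoid (spaces F n) (D₁ ∩ D₂)) (s + 1)) size≡
                 (intersection-size frame))
  , λ n-prime → [ (λ t≡1 → inj₁ (regulus (t≡1⇒ t≡1) frame
                      (≡.trans size≡ (≡.trans (≡.cong (q ^_) t≡1) (ℕ.^-identityʳ q)))))
                , (λ t≡n → inj₂ (commuting⇒coincide frame (m≡1⇒ (m≡1 t≡n)))) ]′
                (prime⇒irreducible n-prime t∣n)
  where
  open Intersection E₁ φ₁-iso E₂ φ₂-iso {D₁} {D₂} D₁-spread D₂-spread
  open CommonSubfield E₁ φ₁-iso E₂ φ₂-iso
  open TwoSpreads E₁ φ₁-iso E₂ φ₂-iso using (Frame)
  frame = proj₂ (proj₂ (Three.frame-exists {R = D₁ ∩ D₂} id three))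
  dims = dimensions (Frame.a≉0 frame)
  t = proj₁ dims
  m = proj₁ (proj₂ dims)
  size≡ = proj₁ (proj₂ (proj₂ dims))
  n≡t*m = proj₁ (proj₂ (proj₂ (proj₂ dims)))
  t≡1⇒ = proj₁ (proj₂ (proj₂ (proj₂ (proj₂ dims))))
  m≡1⇒ = proj₂ (proj₂ (proj₂ (proj₂ (proj₂ dims))))
  t∣n : t ∣ n
  t∣n = divides m (≡.trans n≡t*m (ℕ.*-comm t m))
  -- From `n m = t m = n = n 1`, the nonzero factor `n` is cancelled.
  m≡1 : t ≡ n → m ≡ 1
  m≡1 t≡n = ℕ.*-cancelˡ-≡ m 1 n (≡.trans (≡.trans (≡.cong (_*ℕ m) (≡.sym t≡n)) (≡.sym n≡t*m))
                                (≡.sym (ℕ.*-identityʳ n)))
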